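{- Let $\Gamma$ be one of the lightface pointclasses $\Sigma^0_n$ ($n\ge1$) or $\Pi^0_n$ ($n\ge2$). Let $X$ be a recursive Polish space admitting a $\Sigma^0_1$ strict linear ordering $\prec$, and let $E$ be an equivalence relation on $X$. If $E$ is $\Gamma$-graphable with finite diameter $\ell$, then the Friedman–Stanley jump $E^+$ is $\forall^\mathbb{N}\Gamma$-graphable with diameter $\max(2,\ell)$.
   Context: The Friedman–Stanley jump of $E$ is the equivalence relation $E^+$ on $X^\mathbb{N}$ given by $(x_i)E^+(y_i)$ iff $\{[x_i]_E:i\in\mathbb{N}\}=\{[y_i]_E:i\in\mathbb{N}\}$. $\forall^\mathbb{N}\Gamma$ denotes the pointclass of sets obtained by a universal quantifier over $\mathbb{N}$ in front of a $\Gamma$ relation. An equivalence relation $E$ on $X$ is $\Gamma$-graphable if there is a simple undirected graph $G\subseteq X\times X$ in $\Gamma$ whose connectedness relation (connected by a finite path) equals $E$; it is $\Gamma$-graphable with diameter $k$ if such a $G$ exists in which $k$ is the least integer such that any two $G$-connected points are joined by a path of length at most $k$.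
   Formalization: X is additionally assumed to have at least two distinct points: for a one-point X the equality relation is graphable with diameter 0, while every graph on the one-point space X^N has diameter 0 rather than max(2,0)=2, so the claim fails there. -}

module Defs where

open import Algebra.Bundles using (CommutativeMonoid)
import Algebra.Properties.CommutativeSemigroup as CommutativeSemigroup
open import Level using (0ℓ)
open import Data.Fin using (Fin)
open import Data.Integer using (+_)
open import Data.Nat as ℕ using (ℕ; zero; suc)
open import Data.Product using (Σ; ∃; ∃₂; _×_; _,_; proj₁; proj₂; uncurry)
open import Data.Rational as ℚ using (ℚ; 0ℚ; ½)
open import Data.Rational.Properties as ℚₚ using ()
open import Data.Sum using (_⊎_)
open import Data.Vec using (Vec; []; _∷_; lookup; tabulate)
open import Function.Bundles using (_⇔_)
open import Function.Metric.Structures using (IsGeneralMetric)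
open import Relation.Binary.Bundles using (Setoid)
open import Relation.Binary.Core using (Rel; _⇒_)
open import Relation.Binary.Definitions using (Symmetric; Irreflexive)
open import Relation.Binary.PropositionalEquality as ≡
  using (_≡_; _≢_; refl; subst)
open import Relation.Binary.Structures
  using (IsEquivalence; IsPartialOrder)
open import Relation.Nullary using (¬_)
open import Relation.Unary using (Pred; _⊆_; _≐_; ∁)

------------------------------------------------------------------------
-- Real numbers

-- Two-sided Dedekind cuts of ℚ: lower p means p < x, upper q means x < q.
-- "located" also says that both halves are inhabited.
record ℝ : Set₁ where
  field
    lower upper  : Pred ℚ 0ℓ
    lower-closed : ∀ {p q} → p ℚ.< q → lower q → lower p
    upper-closed : ∀ {p q} → p ℚ.< q → upper p → upper q
    lower-open   : ∀ {p} → lower p → ∃ λ q → p ℚ.< q × lower q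
    upper-open   : ∀ {q} → upper q → ∃ λ p → p ℚ.< q × upper p
    ordered      : ∀ {p q} → lower p → upper q → p ℚ.< q
    located      : ∀ ε → 0ℚ ℚ.< ε →
                   ∃₂ λ p q → lower p × upper q × q ℚ.< p ℚ.+ ε

open ℝ public using (lower; upper)

infix 4 _≃_ _≤_ _<ℚ_ _≤ℚ_

_≤_ : Rel ℝ 0ℓ
x ≤ y = lower x ⊆ lower y × upper y ⊆ upper x

_≃_ : Rel ℝ 0ℓ
x ≃ y = x ≤ y × y ≤ x

_<ℚ_ : ℝ → ℚ → Set
x <ℚ q = upper x q

_≤ℚ_ : ℝ → ℚ → Set
x ≤ℚ q = ¬ lower x q

≤-isPartialOrder : IsPartialOrder _≃_ _≤_
≤-isPartialOrder = record
  { isPreorder = record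
    { isEquivalence = record
      { refl  = λ {x} → ≤-refl x , ≤-refl x
      ; sym   = λ (p , q) → q , p
      ; trans = λ {x} {y} {z} (p , q) (p′ , q′) →
          ≤-trans x y z p p′ , ≤-trans z y x q′ q
      }
    ; reflexive = proj₁
    ; trans     = λ {x} {y} {z} → ≤-trans x y z
    }
  ; antisym = _,_
  }
  where
  ≤-refl : ∀ x → x ≤ x
  ≤-refl x = (λ a → a) , (λ a → a)

  ≤-trans : ∀ x y z → x ≤ y → y ≤ z → x ≤ z
  ≤-trans x y z (l , u) (l′ , u′) = (λ a → l′ (l a)) , (λ a → u (u′ a))

private
  +-cancel : ∀ a b → (a ℚ.+ b) ℚ.- b ≡ a
  +-cancel a b = begin
    (a ℚ.+ b) ℚ.- b  ≡⟨ ℚₚ.+-assoc a b (ℚ.- b) ⟩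
    a ℚ.+ (b ℚ.- b)  ≡⟨ ≡.cong (a ℚ.+_) (ℚₚ.+-inverseʳ b) ⟩
    a ℚ.+ 0ℚ         ≡⟨ ℚₚ.+-identityʳ a ⟩
    a                ∎
    where open ≡.≡-Reasoning

  -‿cancel : ∀ a b → (a ℚ.- b) ℚ.+ b ≡ a
  -‿cancel a b = begin
    (a ℚ.- b) ℚ.+ b        ≡⟨ ℚₚ.+-assoc a (ℚ.- b) b ⟩
    a ℚ.+ (ℚ.- b ℚ.+ b)    ≡⟨ ≡.cong (a ℚ.+_) (ℚₚ.+-inverseˡ b) ⟩
    a ℚ.+ 0ℚ               ≡⟨ ℚₚ.+-identityʳ a ⟩
    a                      ∎
    where open ≡.≡-Reasoning

  halves : ∀ p q ε →
    (p ℚ.+ ½ ℚ.* ε) ℚ.+ (q ℚ.+ ½ ℚ.* ε) ≡ (p ℚ.+ q) ℚ.+ ε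
  halves p q ε = begin
    (p ℚ.+ ½ ℚ.* ε) ℚ.+ (q ℚ.+ ½ ℚ.* ε)  ≡⟨ interchange p (½ ℚ.* ε) q (½ ℚ.* ε) ⟩
    (p ℚ.+ q) ℚ.+ (½ ℚ.* ε ℚ.+ ½ ℚ.* ε)
      ≡⟨ ≡.cong (p ℚ.+ q ℚ.+_) (ℚₚ.*-distribʳ-+ ε ½ ½) ⟨
    (p ℚ.+ q) ℚ.+ (½ ℚ.+ ½) ℚ.* ε        ≡⟨ ≡.cong (p ℚ.+ q ℚ.+_) (ℚₚ.*-identityˡ ε) ⟩
    (p ℚ.+ q) ℚ.+ ε                      ∎
    where
    open ≡.≡-Reasoning
    open CommutativeSemigroup
      (CommutativeMonoid.commutativeSemigroup ℚₚ.+-0-commutativeMonoid)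
      using (interchange)

  gap : ∀ a b ε → a ℚ.< b ℚ.+ ε →
        ∃₂ λ p q → p ℚ.< b × a ℚ.< q × q ℚ.< p ℚ.+ ε
  gap a b ε a<b+ε =
    let (q , a<q , q<b+ε) = ℚₚ.<-dense a<b+ε
        (p , q-ε<p , p<b) = ℚₚ.<-dense
          (subst (q ℚ.- ε ℚ.<_) (+-cancel b ε) (ℚₚ.+-monoˡ-< (ℚ.- ε) q<b+ε))
    in p , q , p<b , a<q ,
       subst (ℚ._< p ℚ.+ ε) (-‿cancel q ε) (ℚₚ.+-monoˡ-< ε q-ε<p)

0ℝ : ℝ
0ℝ = record
  { lower        = ℚ._< 0ℚ
  ; upper        = 0ℚ ℚ.<_
  ; lower-closed = ℚₚ.<-trans
  ; upper-closed = λ p<q 0<p → ℚₚ.<-trans 0<p p<q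
  ; lower-open   = ℚₚ.<-dense
  ; upper-open   = λ 0<q → let (p , 0<p , p<q) = ℚₚ.<-dense 0<q in p , p<q , 0<p
  ; ordered      = ℚₚ.<-trans
  ; located      = λ ε 0<ε →
      let (p , q , p<0 , 0<q , lt) = gap 0ℚ 0ℚ ε
            (subst (0ℚ ℚ.<_) (≡.sym (ℚₚ.+-identityˡ ε)) 0<ε)
      in p , q , p<0 , 0<q , lt
  }

infixl 6 _+_

_+_ : ℝ → ℝ → ℝ
x + y = record
  { lower        = λ r → ∃₂ λ p q → lower x p × lower y q × r ℚ.< p ℚ.+ q
  ; upper        = λ r → ∃₂ λ p q → upper x p × upper y q × p ℚ.+ q ℚ.< r
  ; lower-closed = λ r<s (p , q , a , b , lt) → p , q , a , b , ℚₚ.<-trans r<s lt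
  ; upper-closed = λ r<s (p , q , a , b , lt) → p , q , a , b , ℚₚ.<-trans lt r<s
  ; lower-open   = λ (p , q , a , b , lt) →
      let (s , r<s , s<pq) = ℚₚ.<-dense lt in s , r<s , p , q , a , b , s<pq
  ; upper-open   = λ (p , q , a , b , lt) →
      let (s , pq<s , s<r) = ℚₚ.<-dense lt in s , s<r , p , q , a , b , pq<s
  ; ordered      = λ (p , q , a , b , lt) (p′ , q′ , a′ , b′ , lt′) →
      ℚₚ.<-trans lt (ℚₚ.<-trans
        (ℚₚ.+-mono-< (ℝ.ordered x a a′) (ℝ.ordered y b b′)) lt′)
  ; located      = located-+
  }
  where
  located-+ : ∀ ε → 0ℚ ℚ.< ε → ∃₂ λ r s →
    (∃₂ λ p q → lower x p × lower y q × r ℚ.< p ℚ.+ q) ×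
    (∃₂ λ p q → upper x p × upper y q × p ℚ.+ q ℚ.< s) ×
    s ℚ.< r ℚ.+ ε
  located-+ ε 0<ε =
    let 0<ε/2 = subst (ℚ._< ½ ℚ.* ε) (ℚₚ.*-zeroʳ ½) (ℚₚ.*-monoʳ-<-pos ½ 0<ε)
        (p , p′ , a , a′ , lt)  = ℝ.located x (½ ℚ.* ε) 0<ε/2
        (q , q′ , b , b′ , lt′) = ℝ.located y (½ ℚ.* ε) 0<ε/2
        (r , s , r< , <s , s<r+ε) = gap (p′ ℚ.+ q′) (p ℚ.+ q) ε
          (subst (p′ ℚ.+ q′ ℚ.<_) (halves p q ε) (ℚₚ.+-mono-< lt lt′))
    in r , s , (p , q , a , b , r<) , (p′ , q′ , a′ , b′ , <s) , s<r+ε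

------------------------------------------------------------------------
-- Recursive functions

-- The least class containing zero, successor and the projections and closed
-- under composition, primitive recursion and minimization of f with
-- ∀ v ∃ n (f (n , v) = 0). Each clause takes the pointwise specification of
-- the function it introduces, so that the class is closed under pointwise
-- equality without function extensionality; in "min" the existence of h
-- amounts to the regularity of f.
data IsRecursive : ∀ {k} → (Vec ℕ k → ℕ) → Set where
  zero : ∀ {k} {h : Vec ℕ k → ℕ} → (∀ v → h v ≡ 0) → IsRecursive h
  suc  : ∀ {h : Vec ℕ 1 → ℕ} → (∀ n → h (n ∷ []) ≡ suc n) → IsRecursive h
  proj : ∀ {k} {h : Vec ℕ k → ℕ} (i : Fin k) →
         (∀ v → h v ≡ lookup v i) → IsRecursive h
  comp : ∀ {k m} {h : Vec ℕ k → ℕ} {f : Vec ℕ m → ℕ} {g : Fin m → Vec ℕ k → ℕ} →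
         IsRecursive f → (∀ i → IsRecursive (g i)) →
         (∀ v → h v ≡ f (tabulate (λ i → g i v))) → IsRecursive h
  prim : ∀ {k} {h : Vec ℕ (suc k) → ℕ}
         {f : Vec ℕ k → ℕ} {g : Vec ℕ (suc (suc k)) → ℕ} →
         IsRecursive f → IsRecursive g →
         (∀ v → h (0 ∷ v) ≡ f v) →
         (∀ n v → h (suc n ∷ v) ≡ g (n ∷ h (n ∷ v) ∷ v)) → IsRecursive h
  min  : ∀ {k} {h : Vec ℕ k → ℕ} {f : Vec ℕ (suc k) → ℕ} →
         IsRecursive f →
         (∀ v → f (h v ∷ v) ≡ 0) →
         (∀ v n → n ℕ.< h v → f (n ∷ v) ≢ 0) → IsRecursive h

IsRecursiveRelation : ∀ {k} → Pred (Vec ℕ k) 0ℓ → Set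
IsRecursiveRelation R =
  ∃ λ χ → IsRecursive χ × (∀ v → (R v × χ v ≡ 1) ⊎ (¬ R v × χ v ≡ 0))

------------------------------------------------------------------------
-- Codes

-- A bijection ℕ → ℕ × ℕ, enumerating each antidiagonal from (s , 0) to (0 , s).
unpair : ℕ → ℕ × ℕ
unpair zero = 0 , 0
unpair (suc n) = next (unpair n)
  where
  next : ℕ × ℕ → ℕ × ℕ
  next (zero  , b) = suc b , 0
  next (suc a , b) = a , suc b

π₁ π₂ : ℕ → ℕ
π₁ n = proj₁ (unpair n)
π₂ n = proj₂ (unpair n)

-- Every finite sequence of naturals is an initial segment of some
-- (entry c 0 , entry c 1 , …).
entry : ℕ → ℕ → ℕ
entry c zero    = π₁ c
entry c (suc i) = entry (π₂ c) i

------------------------------------------------------------------------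
-- Spaces with a coded basis

-- The data needed for the lightface hierarchy: a set with equality _≈_ and
-- basic neighbourhoods N 0, N 1, ….
record Space : Set₁ where
  field
    setoid : Setoid 0ℓ 0ℓ
  open Setoid setoid public using (Carrier; _≈_; isEquivalence)
  field
    N      : ℕ → Pred Carrier 0ℓ
    N-resp : ∀ s {x y} → x ≈ y → N s x → N s y

open Space public using (Carrier)

infixr 2 _×ₛ_
infixl 8 _^ℕ

-- N 0 = ∅ and N (suc n) = { n }.
ℕₛ : Space
ℕₛ = record
  { setoid = ≡.setoid ℕ
  ; N      = λ s n → s ≡ suc n
  ; N-resp = λ { s refl p → p }
  }

_×ₛ_ : Space → Space → Space
S ×ₛ T = record
  { setoid = record
    { Carrier       = Carrier S × Carrier T
    ; _≈_           = λ (x , y) (x′ , y′) → x S.≈ x′ × y T.≈ y′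
    ; isEquivalence = record
      { refl  = SE.refl , TE.refl
      ; sym   = λ (p , q) → SE.sym p , TE.sym q
      ; trans = λ (p , q) (p′ , q′) → SE.trans p p′ , TE.trans q q′
      }
    }
  ; N      = λ s (x , y) → S.N (π₁ s) x × T.N (π₂ s) y
  ; N-resp = λ s (p , q) (a , b) → S.N-resp (π₁ s) p a , T.N-resp (π₂ s) q b
  }
  where
  module S  = Space S
  module T  = Space T
  module SE = IsEquivalence S.isEquivalence
  module TE = IsEquivalence T.isEquivalence

-- The sequences, with the product topology: s codes a length π₁ s and one
-- basic neighbourhood for each of the first π₁ s coordinates.
_^ℕ : Space → Space
S ^ℕ = record
  { setoid = record
    { Carrier       = ℕ → Carrier S
    ; _≈_           = λ x y → ∀ i → x i S.≈ y i
    ; isEquivalence = record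
      { refl  = λ i → SE.refl
      ; sym   = λ p i → SE.sym (p i)
      ; trans = λ p q i → SE.trans (p i) (q i)
      }
    }
  ; N      = λ s x → ∀ i → i ℕ.< π₁ s → S.N (entry (π₂ s) i) (x i)
  ; N-resp = λ s p a i i< → S.N-resp (entry (π₂ s) i) (p i) (a i i<)
  }
  where
  module S  = Space S
  module SE = IsEquivalence S.isEquivalence

------------------------------------------------------------------------
-- Recursive Polish spaces

-- A complete separable metric space together with a dense sequence r that is
-- a recursive presentation: the relations d(rᵢ , rⱼ) < m/(k+1) and
-- d(rᵢ , rⱼ) ≤ m/(k+1) of (i , j , m , k) are recursive.
record RecursivePolishSpace : Set₁ where
  field
    Point    : Set
    _≈_      : Rel Point 0ℓ
    d        : Point → Point → ℝ
    isMetric : IsGeneralMetric _≈_ _≃_ _≤_ 0ℝ _+_ d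
    complete : (x : ℕ → Point) →
      (∀ ε → 0ℚ ℚ.< ε → ∃ λ n → ∀ i j → n ℕ.≤ i → n ℕ.≤ j → d (x i) (x j) <ℚ ε) →
      ∃ λ y → ∀ ε → 0ℚ ℚ.< ε → ∃ λ n → ∀ i → n ℕ.≤ i → d (x i) y <ℚ ε
    r        : ℕ → Point
    dense    : ∀ x ε → 0ℚ ℚ.< ε → ∃ λ i → d x (r i) <ℚ ε
    recursive-< : IsRecursiveRelation {4}
      λ { (i ∷ j ∷ m ∷ k ∷ []) → d (r i) (r j) <ℚ (+ m ℚ./ suc k) }
    recursive-≤ : IsRecursiveRelation {4}
      λ { (i ∷ j ∷ m ∷ k ∷ []) → d (r i) (r j) ≤ℚ (+ m ℚ./ suc k) }

  open IsGeneralMetric isMetric using (≈-isEquivalence; cong; module EqC)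

  -- N s is the open ball with centre r(s₀) and radius s₁/(s₂+1), where sᵢ is
  -- entry s i; for s₁ = 0 it is empty.
  space : Space
  space = record
    { setoid = record { isEquivalence = ≈-isEquivalence }
    ; N      = λ s x → d x (r (entry s 0)) <ℚ (+ entry s 1 ℚ./ suc (entry s 2))
    ; N-resp = λ s x≈y a → proj₂ (proj₂ (cong x≈y EqC.refl)) a
    }

open RecursivePolishSpace public using (space)

------------------------------------------------------------------------
-- Lightface pointclasses

Pointclass : Set₂
Pointclass = (S : Space) → Pred (Carrier S) 0ℓ → Set₁

-- Σ⁰₁ sets are the recursively enumerated unions of basic neighbourhoods,
-- Π⁰ₙ = ¬ Σ⁰ₙ and Σ⁰ₙ₊₁ = ∃^ℕ Π⁰ₙ (n ≥ 1); Σ⁰ 0 and Π⁰ 0 are empty.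
mutual
  data Σ⁰ : ℕ → Pointclass where
    union : ∀ {S A} (ε : Vec ℕ 1 → ℕ) → IsRecursive ε →
            A ≐ (λ x → ∃ λ n → Space.N S (ε (n ∷ [])) x) → Σ⁰ 1 S A
    proj  : ∀ {n S A} (B : Pred (Carrier S × ℕ) 0ℓ) → Π⁰ (suc n) (S ×ₛ ℕₛ) B →
            A ≐ (λ x → ∃ λ m → B (x , m)) → Σ⁰ (suc (suc n)) S A

  data Π⁰ : ℕ → Pointclass where
    compl : ∀ {n S A} (B : Pred (Carrier S) 0ℓ) → Σ⁰ n S B → A ≐ ∁ B → Π⁰ n S A

data IsLightface : Pointclass → Set₂ where
  sigma : ∀ {n} → 1 ℕ.≤ n → IsLightface (Σ⁰ n)
  pi    : ∀ {n} → 2 ℕ.≤ n → IsLightface (Π⁰ n)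

∀ᴺ : Pointclass → Pointclass
∀ᴺ Γ S A = Σ (Pred (Carrier S × ℕ) 0ℓ) λ B →
  Γ (S ×ₛ ℕₛ) B × A ≐ (λ x → ∀ m → B (x , m))

------------------------------------------------------------------------
-- Graphable equivalence relations

-- The inclusion of ≈ makes E a relation on the set of points up to ≈.
record IsEquivalenceOn (S : Space) (E : Rel (Carrier S) 0ℓ) : Set where
  field
    isEquivalence : IsEquivalence E
    reflexive     : Space._≈_ S ⇒ E

-- Path S G n x y: a path of length n from x to y.
data Path (S : Space) (G : Rel (Carrier S) 0ℓ) : ℕ → Rel (Carrier S) 0ℓ where
  stop : ∀ {x y} → Space._≈_ S x y → Path S G 0 x y
  step : ∀ {n x y z} → G x y → Path S G n y z → Path S G (suc n) x z

Connected : (S : Space) → Rel (Carrier S) 0ℓ → Rel (Carrier S) 0ℓ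
Connected S G x y = ∃ λ n → Path S G n x y

DiameterAtMost : (S : Space) → Rel (Carrier S) 0ℓ → ℕ → Set
DiameterAtMost S G k =
  ∀ x y → Connected S G x y → ∃ λ n → n ℕ.≤ k × Path S G n x y

HasDiameter : (S : Space) → Rel (Carrier S) 0ℓ → ℕ → Set
HasDiameter S G k =
  DiameterAtMost S G k × (∀ m → DiameterAtMost S G m → k ℕ.≤ m)

record IsGraphing (Γ : Pointclass) (S : Space)
                  (E G : Rel (Carrier S) 0ℓ) : Set₁ where
  field
    symmetric   : Symmetric G
    irreflexive : Irreflexive (Space._≈_ S) G
    inΓ         : Γ (S ×ₛ S) (uncurry G)
    connected⇔E : ∀ x y → Connected S G x y ⇔ E x y

GraphableWithDiameter :
  Pointclass → (S : Space) → Rel (Carrier S) 0ℓ → ℕ → Set₁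
GraphableWithDiameter Γ S E k =
  Σ (Rel (Carrier S) 0ℓ) λ G → IsGraphing Γ S E G × HasDiameter S G k

-- The set of classes { [xᵢ]_E } equals { [yᵢ]_E }; the class of x is E x.
infix 10 _⁺

_⁺ : ∀ {A : Set} → Rel A 0ℓ → Rel (ℕ → A) 0ℓ
(E ⁺) x y = (∀ i → ∃ λ j → E (x i) ≐ E (y j))
          × (∀ j → ∃ λ i → E (y j) ≐ E (x i))

module Submission where

-- Write x ~ z for "x G z or x ≈ z". Linked sequences in the graph of E ⁺ either
-- satisfy x i ~ z i for all i, or one of them, z, carries a code of a function
-- f with z j ~ x (f j) for all j, each bit of which is an (in)equality between
-- two entries of z; thus both inclusions between the sets of classes are
-- expressed by one number quantifier in front of Γ. Given x E⁺ y, take paths of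
-- length L = max(2,ℓ) between matching entries of x and y: for 0 < s < L the
-- s-th points of these paths, listed in a suitable order so as to carry the
-- codes, form the s-th vertex of a path from x to y. If these points all
-- coincide, then no bits can be coded, but none are needed.
--
-- Every edge has an endpoint in which two fixed entries agree; this keeps the
-- diameter from being 1. That it is at least ℓ is seen on constant sequences.
--
-- The complexity is computed with uniformly Σ⁰ₙ families: as ≉ is Σ⁰₁ by ≺ and
-- Σ⁰₂ by the metric, it belongs to all the higher classes.

open import Level using (0ℓ)
open import Axiom.DoubleNegationElimination using (em⇒dne)
open import Axiom.ExcludedMiddle using (ExcludedMiddle)
open import Data.Bool using (Bool; true; false; not; if_then_else_)
import Data.Bool.Properties as Boolₚ
open import Data.Fin using (zero; suc)
open import Data.Integer as ℤ using (+_; -[1+_])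
open import Data.Nat
  using (ℕ; zero; suc; pred; _+_; _∸_; _⊔_; _<_; _≤_; _≡ᵇ_; z≤n; s≤s; s≤s⁻¹)
import Data.Nat.Properties as ℕₚ
open import Data.Product using (Σ; ∃; ∃₂; _×_; _,_; proj₁; proj₂; uncurry)
open import Data.Rational as ℚ using (ℚ; mkℚ; 0ℚ; ½)
import Data.Rational.Properties as ℚₚ
open import Data.Rational.Unnormalised using (mkℚᵘ; *<*)
import Data.Rational.Unnormalised.Properties as ℚᵘₚ
open import Data.Sum using (_⊎_; inj₁; inj₂; swap)
open import Data.Vec using (Vec; []; _∷_; lookup)
open import Data.Vec.Properties using (tabulate∘lookup)
open import Function.Base using (_∘_)
open import Function.Bundles using (_⇔_; mk⇔; Equivalence)
open import Function.Metric.Structures using (IsGeneralMetric)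
open import Relation.Binary.Core using (Rel)
open import Relation.Binary.Definitions using (Symmetric; tri<; tri≈; tri>)
open import Relation.Binary.PropositionalEquality
  using (_≡_; refl; sym; trans; cong; cong₂; subst; subst₂; module ≡-Reasoning)
open import Relation.Binary.Structures using (IsEquivalence; IsStrictTotalOrder)
open import Relation.Nullary using (¬_; yes; no; contradiction; _×-dec_)
open import Relation.Unary using (_≐_)
open import Defs hiding (_+_; _≤_; _≃_)

open Equivalence using (to; from)

-- Pairing

triangle : ℕ → ℕ
triangle zero    = zero
triangle (suc n) = suc n + triangle n

-- Cantor's pairing: `triangle (a + b)` pairs lie on earlier antidiagonals, and (a , b) stands at
-- position `b` on its own.
pair : ℕ → ℕ → ℕ
pair a b = triangle (a + b) + b

private
  unpair-down : ∀ n {a b} → unpair n ≡ (suc a , b) → unpair (suc n) ≡ (a , suc b)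
  unpair-down n eq rewrite eq = refl

  unpair-turn : ∀ n {b} → unpair n ≡ (0 , b) → unpair (suc n) ≡ (suc b , 0)
  unpair-turn n eq rewrite eq = refl

unpair-pair : ∀ a b → unpair (pair a b) ≡ (a , b)
unpair-pair a b = go (a + b) a b refl
  where
  -- Each antidiagonal is walked back to its start (s , 0), which is preceded by the end (0 , s - 1)
  -- of the previous one; the recursion is lexicographic in `s` and `b`.
  go : ∀ s a b → a + b ≡ s → unpair (pair a b) ≡ (a , b)
  go s a (suc b) eq =
    trans (cong unpair shift)
      (unpair-down (pair (suc a) b) (go s (suc a) b (trans (sym (ℕₚ.+-suc a b)) eq)))
    where
    shift : pair a (suc b) ≡ suc (pair (suc a) b)
    shift = trans (ℕₚ.+-suc _ b) (cong (λ s → suc (triangle s + b)) (ℕₚ.+-suc a b))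
  go s       zero    zero _  = refl
  go (suc s) (suc a) zero eq =
    trans (cong unpair shift)
      (unpair-turn (pair 0 a)
        (go s 0 a (trans (sym (ℕₚ.+-identityʳ a)) (ℕₚ.suc-injective eq))))
    where
    shift : pair (suc a) 0 ≡ suc (pair 0 a)
    shift = begin
      triangle (suc a + 0) + 0  ≡⟨ ℕₚ.+-identityʳ _ ⟩
      triangle (suc a + 0)      ≡⟨ cong triangle (ℕₚ.+-identityʳ (suc a)) ⟩
      suc (a + triangle a)      ≡⟨ cong suc (ℕₚ.+-comm a _) ⟩
      suc (triangle a + a)      ∎
      where open ≡-Reasoning

π₁-pair : ∀ a b → π₁ (pair a b) ≡ a
π₁-pair a b = cong proj₁ (unpair-pair a b)

π₂-pair : ∀ a b → π₂ (pair a b) ≡ b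
π₂-pair a b = cong proj₂ (unpair-pair a b)

pair-unpair : ∀ n → pair (π₁ n) (π₂ n) ≡ n
pair-unpair zero = refl
pair-unpair (suc n) with unpair n | pair-unpair n
... | zero  , b | eq = begin
  triangle (suc b + 0) + 0  ≡⟨ ℕₚ.+-identityʳ _ ⟩
  triangle (suc b + 0)      ≡⟨ cong triangle (ℕₚ.+-identityʳ (suc b)) ⟩
  suc (b + triangle b)      ≡⟨ cong suc (ℕₚ.+-comm b _) ⟩
  suc (triangle b + b)      ≡⟨ cong suc eq ⟩
  suc n                     ∎
  where open ≡-Reasoning
... | suc a , b | eq = begin
  triangle (a + suc b) + suc b    ≡⟨ ℕₚ.+-suc _ b ⟩
  suc (triangle (a + suc b) + b)  ≡⟨ cong (λ s → suc (triangle s + b)) (ℕₚ.+-suc a b) ⟩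
  suc (triangle (suc a + b) + b)  ≡⟨ cong suc eq ⟩
  suc n                           ∎
  where open ≡-Reasoning

π₁≤ : ∀ n → π₁ n ≤ n
π₁≤ n = subst (π₁ n ≤_) (pair-unpair n) (bound (π₁ n) (π₂ n))
  where
  n≤triangle : ∀ n → n ≤ triangle n
  n≤triangle zero    = z≤n
  n≤triangle (suc n) = ℕₚ.m≤m+n (suc n) _
  bound : ∀ a b → a ≤ pair a b
  bound a b = ℕₚ.≤-trans (ℕₚ.m≤m+n a b)
    (ℕₚ.≤-trans (n≤triangle (a + b)) (ℕₚ.m≤m+n _ b))

-- The only pair whose code equals its second component is (0 , 0). With `π₁≤` this makes recursion
-- through `π₁ ∘ π₂` well founded.
π₂-suc≤ : ∀ n → π₂ (suc n) ≤ n
π₂-suc≤ n = s≤s⁻¹ (bound (π₁ (suc n)) (π₂ (suc n)) (pair-unpair (suc n)))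
  where
  bound : ∀ a b → pair a b ≡ suc n → b < suc n
  bound zero    zero    ()
  bound a       (suc b) eq = subst (suc b <_) eq
    (subst (λ s → suc b < triangle s + suc b) (sym (ℕₚ.+-suc a b)) (s≤s (ℕₚ.m≤n+m (suc b) _)))
  bound (suc a) zero    _  = s≤s z≤n

-- Recursive functions

Rec : (ℕ → ℕ) → Set
Rec f = IsRecursive {1} (λ v → f (lookup v zero))

Rec₂ : (ℕ → ℕ → ℕ) → Set
Rec₂ f = IsRecursive {2} (λ v → f (lookup v zero) (lookup v (suc zero)))

app : ∀ {k} f {g : Vec ℕ k → ℕ} → Rec f → IsRecursive g → IsRecursive (λ v → f (g v))
app f {g} F G = comp {g = λ _ → g} F (λ _ → G) (λ _ → refl)

app₂ : ∀ {k} f {g h : Vec ℕ k → ℕ} → Rec₂ f → IsRecursive g → IsRecursive h →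
       IsRecursive (λ v → f (g v) (h v))
app₂ f {g} {h} F G H =
  comp {g = λ { zero → g ; (suc zero) → h }} F (λ { zero → G ; (suc zero) → H }) (λ _ → refl)

-- The clause `comp` specifies its function only pointwise, so composing with the projections
-- absorbs the equality.
ext-rec : ∀ {k} {f g : Vec ℕ k → ℕ} → (∀ v → g v ≡ f v) → IsRecursive f → IsRecursive g
ext-rec {k} {f} g≡f F = comp {g = λ i v → lookup v i} F (λ i → proj i (λ _ → refl))
  (λ v → trans (g≡f v) (cong f (sym (tabulate∘lookup v))))

var : ∀ {k} i → IsRecursive {k} (λ v → lookup v i)
var i = proj i (λ _ → refl)

id-rec : Rec (λ n → n)
id-rec = var zero

ifz : ℕ → ℕ → ℕ → ℕ
ifz zero    a b = a
ifz (suc _) a b = b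

-- One of the two truncated differences vanishes, so this is |m - n|; it brings equality tests into
-- the form `h m ≡ 0`.
dist : ℕ → ℕ → ℕ
dist m n = (m ∸ n) + (n ∸ m)

≡⇒dist≡0 : ∀ {m n} → m ≡ n → dist m n ≡ 0
≡⇒dist≡0 {m} refl = cong₂ _+_ (ℕₚ.n∸n≡0 m) (ℕₚ.n∸n≡0 m)

dist≡0⇒≡ : ∀ m n → dist m n ≡ 0 → m ≡ n
dist≡0⇒≡ m n eq = ℕₚ.≤-antisym
  (ℕₚ.m∸n≡0⇒m≤n (ℕₚ.m+n≡0⇒m≡0 (m ∸ n) eq)) (ℕₚ.m∸n≡0⇒m≤n (ℕₚ.m+n≡0⇒n≡0 (m ∸ n) eq))

module _ {k} {f : Vec ℕ k → ℕ} (F : IsRecursive f) where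

  suc-rec : IsRecursive (λ v → suc (f v))
  suc-rec = app suc (suc (λ _ → refl)) F

  pred-rec : IsRecursive (λ v → pred (f v))
  pred-rec = app pred
    (prim {f = λ _ → 0} {g = λ v → lookup v zero}
      (zero (λ _ → refl)) (var zero) (λ _ → refl) (λ _ _ → refl))
    F

const-rec : ∀ {k} c → IsRecursive {k} (λ _ → c)
const-rec zero    = zero (λ _ → refl)
const-rec (suc c) = suc-rec (const-rec c)

module _ {k} {f g : Vec ℕ k → ℕ} (F : IsRecursive f) (G : IsRecursive g) where

  +-rec : IsRecursive (λ v → f v + g v)
  +-rec = app₂ _+_
    (prim {f = λ v → lookup v zero} {g = λ v → suc (lookup v (suc zero))}
      id-rec (suc-rec (var (suc zero))) (λ _ → refl) (λ _ _ → refl))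
    F G

  ∸-rec : IsRecursive (λ v → f v ∸ g v)
  ∸-rec = app₂ (λ n m → m ∸ n)
    (prim {f = λ v → lookup v zero} {g = λ v → pred (lookup v (suc zero))}
      id-rec (pred-rec (var (suc zero)))
      (λ _ → refl) (λ n v → sym (ℕₚ.pred[m∸n]≡m∸[1+n] (lookup v zero) n)))
    G F

dist-rec : ∀ {k} {f g : Vec ℕ k → ℕ} → IsRecursive f → IsRecursive g →
           IsRecursive (λ v → dist (f v) (g v))
dist-rec F G = +-rec (∸-rec F G) (∸-rec G F)

ifz-rec : ∀ {k} {f g h : Vec ℕ k → ℕ} → IsRecursive f → IsRecursive g → IsRecursive h →
          IsRecursive (λ v → ifz (f v) (g v) (h v))
ifz-rec {f = f} {g} {h} F G H =
  comp {m = 3} {f = λ v → ifz (lookup v zero) (lookup v (suc zero)) (lookup v (suc (suc zero)))}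
       {g = λ { zero → f ; (suc zero) → g ; (suc (suc zero)) → h }}
    (prim {f = λ v → lookup v zero} {g = λ v → lookup v (suc (suc (suc zero)))}
      (var zero) (var (suc (suc (suc zero)))) (λ _ → refl) (λ _ _ → refl))
    (λ { zero → F ; (suc zero) → G ; (suc (suc zero)) → H }) (λ _ → refl)

triangle-rec : ∀ {k} {f : Vec ℕ k → ℕ} → IsRecursive f → IsRecursive (λ v → triangle (f v))
triangle-rec = app triangle
  (prim {f = λ _ → 0} {g = λ v → suc (lookup v zero) + lookup v (suc zero)}
    (const-rec 0) (+-rec (suc-rec (var zero)) (var (suc zero))) (λ _ → refl) (λ _ _ → refl))

pair-rec : ∀ {k} {f g : Vec ℕ k → ℕ} → IsRecursive f → IsRecursive g →
           IsRecursive (λ v → pair (f v) (g v))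
pair-rec F G = +-rec (triangle-rec (+-rec F G)) G

private
  -- The sum s of the components of `unpair n` grows exactly at the end of an antidiagonal, where
  -- `π₁ n` is 0. As π₂ n = n ∸ triangle s and π₁ n = s ∸ π₂ n, it obeys a primitive recursion from
  -- which both components are read off.
  sum-step : ℕ → ℕ → ℕ
  sum-step n s = ifz (s ∸ (n ∸ triangle s)) (suc s) s

  π-sum : ℕ → ℕ
  π-sum n = π₁ n + π₂ n

  ∸-triangle : ∀ n → n ∸ triangle (π-sum n) ≡ π₂ n
  ∸-triangle n = begin
    n ∸ triangle (π-sum n)                    ≡⟨ cong (_∸ triangle (π-sum n)) (pair-unpair n) ⟨
    pair (π₁ n) (π₂ n) ∸ triangle (π-sum n)   ≡⟨ ℕₚ.m+n∸m≡n (triangle (π-sum n)) (π₂ n) ⟩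
    π₂ n                                      ∎
    where open ≡-Reasoning

  π₁-as-∸ : ∀ n → π-sum n ∸ (n ∸ triangle (π-sum n)) ≡ π₁ n
  π₁-as-∸ n = trans (cong (π-sum n ∸_) (∸-triangle n)) (ℕₚ.m+n∸n≡m (π₁ n) (π₂ n))

  π-sum-suc : ∀ n → π-sum (suc n) ≡ sum-step n (π-sum n)
  π-sum-suc n = trans turn (cong (λ a → ifz a (suc (π-sum n)) (π-sum n)) (sym (π₁-as-∸ n)))
    where
    turn : π-sum (suc n) ≡ ifz (π₁ n) (suc (π-sum n)) (π-sum n)
    turn with unpair n
    ... | zero  , b = cong suc (ℕₚ.+-identityʳ b)
    ... | suc a , b = ℕₚ.+-suc a b

  π-sum-rec : Rec π-sum
  π-sum-rec = prim {f = λ _ → 0} {g = λ v → sum-step (lookup v zero) (lookup v (suc zero))}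
    (const-rec 0)
    (ifz-rec (∸-rec s (∸-rec (var zero) (triangle-rec s))) (suc-rec s) s)
    (λ _ → refl) (λ n _ → π-sum-suc n)
    where s = var (suc zero)

module _ {k} {f : Vec ℕ k → ℕ} (F : IsRecursive f) where

  π₂-rec : IsRecursive (λ v → π₂ (f v))
  π₂-rec = app π₂
    (ext-rec (λ v → sym (∸-triangle (lookup v zero)))
      (∸-rec id-rec (triangle-rec π-sum-rec)))
    F

  π₁-rec : IsRecursive (λ v → π₁ (f v))
  π₁-rec = app π₁
    (ext-rec (λ v → sym (π₁-as-∸ (lookup v zero)))
      (∸-rec π-sum-rec (∸-rec id-rec (triangle-rec π-sum-rec))))
    F

private
  -- In the recursion of `entry` the code varies; applying `π₂` on the outside keeps it as a fixed
  -- parameter of a primitive recursion.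
  π₂-iterate : ℕ → ℕ → ℕ
  π₂-iterate zero    c = c
  π₂-iterate (suc i) c = π₂ (π₂-iterate i c)

  π₂-iterate-π₂ : ∀ i c → π₂-iterate i (π₂ c) ≡ π₂ (π₂-iterate i c)
  π₂-iterate-π₂ zero    c = refl
  π₂-iterate-π₂ (suc i) c = cong π₂ (π₂-iterate-π₂ i c)

  entry-iterate : ∀ c i → entry c i ≡ π₁ (π₂-iterate i c)
  entry-iterate c zero    = refl
  entry-iterate c (suc i) = trans (entry-iterate (π₂ c) i) (cong π₁ (π₂-iterate-π₂ i c))

entry-rec : ∀ {k} {f g : Vec ℕ k → ℕ} → IsRecursive f → IsRecursive g →
            IsRecursive (λ v → entry (f v) (g v))
entry-rec {f = f} {g} F G =
  ext-rec (λ v → entry-iterate (f v) (g v))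
    (π₁-rec (app₂ π₂-iterate
      (prim {f = λ v → lookup v zero} {g = λ v → π₂ (lookup v (suc zero))}
        id-rec (π₂-rec (var (suc zero))) (λ _ → refl) (λ _ _ → refl))
      G F))

entry-surjective : ∀ (t : ℕ → ℕ) n → ∃ λ c → ∀ i → i < n → entry c i ≡ t i
entry-surjective t zero    = 0 , λ _ ()
entry-surjective t (suc n) =
  let (c , eq) = entry-surjective (t ∘ suc) n in
  pair (t 0) c , λ
    { zero    _         → π₁-pair (t 0) c
    ; (suc i) (s≤s i<n) →
        trans (cong (λ c → entry c i) (π₂-pair (t 0) c)) (eq i i<n)
    }


-- Uniform pointclasses

cast : ∀ {A B : Set} → A ≡ B → A → B
cast = subst (λ A → A)

-- The level is arbitrary so that `f` may be a relation; `cast` then transports along the resulting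
-- equality of types.
unpaired : ∀ {ℓ} {A : Set ℓ} (f : ℕ → ℕ → A) a b →
           f (π₁ (pair a b)) (π₂ (pair a b)) ≡ f a b
unpaired f a b = cong₂ f (π₁-pair a b) (π₂-pair a b)

Param : Space → Set₁
Param S = Carrier S → ℕ → Set

-- A uniformly Σ⁰₁ family of sets; the value 0 of the enumeration means that
-- nothing is enumerated, as S need not have an empty basic neighbourhood.
record Open (S : Space) (P : Param S) : Set₁ where
  field
    enum     : ℕ → ℕ → ℕ
    enum-rec : Rec₂ enum
    enum⇔    : ∀ x m → P x m ⇔ ∃₂ λ j s → enum m j ≡ suc s × Space.N S s x

open Open

-- Sg S n consists of the uniformly Σ⁰ₙ₊₁ families.
Sg : (S : Space) → ℕ → Param S → Set₁
Sg S zero    P = Open S P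
Sg S (suc n) P = Σ (Param S) λ Q → Sg S n Q × (∀ x m → P x m ⇔ ∃ λ k → ¬ Q x (pair m k))

-- Unlike a disjunction, this choice commutes with the prefix "there is k such that not", so it
-- passes down through all levels.
Cases : ℕ → Set → Set → Set
Cases zero    A B = A
Cases (suc _) A B = B

module _ {S : Space} where

  Sg-resp : ∀ n {P Q : Param S} → (∀ x m → P x m ⇔ Q x m) → Sg S n P → Sg S n Q
  Sg-resp zero    P⇔Q O = record
    { enum     = enum O
    ; enum-rec = enum-rec O
    ; enum⇔    = λ x m → mk⇔ (to (enum⇔ O x m) ∘ from (P⇔Q x m))
                             (to (P⇔Q x m) ∘ from (enum⇔ O x m))
    }
  Sg-resp (suc n) P⇔Q (R , r , P⇔R) = R , r , λ x m →
    mk⇔ (to (P⇔R x m) ∘ from (P⇔Q x m)) (to (P⇔Q x m) ∘ from (P⇔R x m))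

  Open-N : Open S (λ x m → Space.N S m x)
  Open-N = record
    { enum     = λ m _ → suc m
    ; enum-rec = suc-rec (var zero)
    ; enum⇔    = λ x m → mk⇔ (λ a → 0 , m , refl , a) λ { (_ , _ , refl , a) → a }
    }

  Sg-reparam : ∀ n {P : Param S} h → Rec h → Sg S n P → Sg S n (λ x m → P x (h m))
  Sg-reparam zero    h H O = record
    { enum     = λ m j → enum O (h m) j
    ; enum-rec = app₂ (enum O) (enum-rec O) (app h H (var zero)) (var (suc zero))
    ; enum⇔    = λ x m → enum⇔ O x (h m)
    }
  Sg-reparam (suc n) {P} h H (Q , q , P⇔Q) =
    (λ x m → Q x (pair (h (π₁ m)) (π₂ m))) ,
    Sg-reparam n _ (pair-rec (app h H (π₁-rec id-rec)) (π₂-rec id-rec)) q ,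
    λ x m → mk⇔
      (λ a → let (k , b) = to (P⇔Q x (h m)) a in
             k , subst ¬_ (sym (eq x m k)) b)
      (λ (k , b) → from (P⇔Q x (h m)) (k , subst ¬_ (eq x m k) b))
    where
    eq : ∀ x m k → Q x (pair (h (π₁ (pair m k))) (π₂ (pair m k))) ≡ Q x (pair (h m) k)
    eq x m k = unpaired (λ a b → Q x (pair (h a) b)) m k

  -- Where the test fails, the enumeration takes only the value 0, that is, enumerates nothing.
  Open-guard : ∀ {P : Param S} h → Rec h → Open S P → Open S (λ x m → h m ≡ 0 × P x m)
  Open-guard {P} h H O = record
    { enum     = λ m j → ifz (h m) (enum O m j) 0
    ; enum-rec = ifz-rec (app h H (var zero)) (enum-rec O) (const-rec 0)
    ; enum⇔    = λ x m → mk⇔ (λ (z , a) → on x m z (to (enum⇔ O x m) a)) (off x m)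
    }
    where
    Enumerated : ℕ → Carrier S → ℕ → Set
    Enumerated g x m = ∃₂ λ j s → ifz g (enum O m j) 0 ≡ suc s × Space.N S s x
    on : ∀ x m → h m ≡ 0 → Enumerated 0 x m → Enumerated (h m) x m
    on x m z a rewrite z = a
    off : ∀ x m → Enumerated (h m) x m → h m ≡ 0 × P x m
    off x m a with h m
    ... | zero = refl , from (enum⇔ O x m) a
    off x m (_ , _ , () , _) | suc _

  -- The new quantifier is contracted by pairing with the search of the enumeration or with the
  -- leading quantifier.
  Sg-∃ : ∀ n {P : Param S} → Sg S n P → Sg S n (λ x m → ∃ λ k → P x (pair m k))
  Sg-∃ zero    O = record
    { enum     = λ m i → enum O (pair m (π₁ i)) (π₂ i)
    ; enum-rec = app₂ (enum O) (enum-rec O)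
        (pair-rec (var zero) (π₁-rec (var (suc zero)))) (π₂-rec (var (suc zero)))
    ; enum⇔    = λ x m → mk⇔
        (λ (k , a) → let (j , s , e , b) = to (enum⇔ O x (pair m k)) a in
          pair k j , s , trans (unpaired (λ a b → enum O (pair m a) b) k j) e , b)
        (λ (i , a) → π₁ i , from (enum⇔ O x (pair m (π₁ i))) (π₂ i , a))
    }
  Sg-∃ (suc n) {P} (Q , q , P⇔Q) =
    _ ,
    Sg-reparam n h (pair-rec (pair-rec (π₁-rec id-rec) (π₁-rec (π₂-rec id-rec)))
                             (π₂-rec (π₂-rec id-rec))) q ,
    λ x m → mk⇔
      (λ (k , a) → let (l , b) = to (P⇔Q x (pair m k)) a in
        pair k l , subst (¬_ ∘ Q x)
          (sym (trans (eq m (pair k l)) (unpaired (λ a b → pair (pair m a) b) k l))) b)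
      (λ (i , b) → π₁ i , from (P⇔Q x (pair m (π₁ i)))
        (π₂ i , subst (¬_ ∘ Q x) (eq m i) b))
    where
    h : ℕ → ℕ
    h y = pair (pair (π₁ y) (π₁ (π₂ y))) (π₂ (π₂ y))
    eq : ∀ m i → h (pair m i) ≡ pair (pair m (π₁ i)) (π₂ i)
    eq = unpaired (λ a b → pair (pair a (π₁ b)) (π₂ b))

  Sg-cases : ∀ n {P Q : Param S} → Sg S n P → Sg S n Q →
             Sg S n (λ x m → Cases (π₁ m) (P x (π₂ m)) (Q x (π₂ m)))
  Sg-cases zero    {P} {Q} O O′ = record
    { enum     = λ m j → ifz (π₁ m) (enum O (π₂ m) j) (enum O′ (π₂ m) j)
    ; enum-rec = ifz-rec (π₁-rec (var zero))
        (app₂ (enum O) (enum-rec O) (π₂-rec (var zero)) (var (suc zero)))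
        (app₂ (enum O′) (enum-rec O′) (π₂-rec (var zero)) (var (suc zero)))
    ; enum⇔    = λ x m → split (π₁ m) x (π₂ m)
    }
    where
    split : ∀ c x m → Cases c (P x m) (Q x m) ⇔
            ∃₂ λ j s → ifz c (enum O m j) (enum O′ m j) ≡ suc s × Space.N S s x
    split zero    = enum⇔ O
    split (suc _) = enum⇔ O′
  Sg-cases (suc n) {P} {Q} (P′ , p , P⇔) (Q′ , q , Q⇔) =
    _ ,
    Sg-reparam n h (pair-rec (π₁-rec (π₁-rec id-rec))
                             (pair-rec (π₂-rec (π₁-rec id-rec)) (π₂-rec id-rec)))
      (Sg-cases n p q) ,
    λ x m → mk⇔
      (λ a → let (k , b) = to (split (π₁ m) x (π₂ m)) a in k , subst ¬_ (sym (eq x m k)) b)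
      (λ (k , b) → from (split (π₁ m) x (π₂ m)) (k , subst ¬_ (eq x m k) b))
    where
    h : ℕ → ℕ
    h y = pair (π₁ (π₁ y)) (pair (π₂ (π₁ y)) (π₂ y))
    C : Param S
    C x m = Cases (π₁ m) (P′ x (π₂ m)) (Q′ x (π₂ m))
    eq : ∀ x m k → C x (h (pair m k)) ≡
         Cases (π₁ m) (P′ x (pair (π₂ m) k)) (Q′ x (pair (π₂ m) k))
    eq x m k = trans
      (unpaired (λ a b → C x (pair (π₁ a) (pair (π₂ a) b))) m k)
      (unpaired (λ a b → Cases a (P′ x b) (Q′ x b)) (π₁ m) (pair (π₂ m) k))
    split : ∀ c x m → Cases c (P x m) (Q x m) ⇔
            ∃ λ k → ¬ Cases c (P′ x (pair m k)) (Q′ x (pair m k))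
    split zero    = P⇔
    split (suc _) = Q⇔

  -- A union is an existential quantifier over the number of the case.
  Sg-∪ : ∀ n {P Q : Param S} → Sg S n P → Sg S n Q → Sg S n (λ x m → P x m ⊎ Q x m)
  Sg-∪ n {P} {Q} p q = Sg-resp n
    (λ x m → mk⇔
      (λ (k , a) → split x m k (cast (eq x m k) a))
      λ { (inj₁ a) → 0 , cast (sym (eq x m 0)) a
        ; (inj₂ b) → 1 , cast (sym (eq x m 1)) b })
    (Sg-∃ n (Sg-reparam n (λ y → pair (π₂ y) (π₁ y))
      (pair-rec (π₂-rec id-rec) (π₁-rec id-rec)) (Sg-cases n p q)))
    where
    C : Param S
    C x m = Cases (π₁ m) (P x (π₂ m)) (Q x (π₂ m))
    eq : ∀ x m k → C x (pair (π₂ (pair m k)) (π₁ (pair m k))) ≡ Cases k (P x m) (Q x m)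
    eq x m k = trans (unpaired (λ a b → C x (pair b a)) m k)
                     (unpaired (λ a b → Cases a (P x b) (Q x b)) k m)
    split : ∀ x m k → Cases k (P x m) (Q x m) → P x m ⊎ Q x m
    split x m zero    = inj₁
    split x m (suc _) = inj₂

  -- Both leading quantifiers are paired, and the conjunction of the negations is the negation of a
  -- union one level below. Level 0 is excluded because two basic neighbourhoods of a `Space` need
  -- not contain a common one.
  Sg-∩ : ∀ n {P Q : Param S} → Sg S (suc n) P → Sg S (suc n) Q →
         Sg S (suc n) (λ x m → P x m × Q x m)
  Sg-∩ n {P} {Q} (P′ , p , P⇔) (Q′ , q , Q⇔) =
    _ ,
    Sg-∪ n (Sg-reparam n (λ y → pair (π₁ y) (π₁ (π₂ y)))
             (pair-rec (π₁-rec id-rec) (π₁-rec (π₂-rec id-rec))) p)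
           (Sg-reparam n (λ y → pair (π₁ y) (π₂ (π₂ y)))
             (pair-rec (π₁-rec id-rec) (π₂-rec (π₂-rec id-rec))) q) ,
    λ x m → mk⇔
      (λ (a , b) →
        let (k , a′) = to (P⇔ x m) a
            (l , b′) = to (Q⇔ x m) b
        in pair k l , λ
          { (inj₁ c) → a′ (subst (P′ x) (trans (unpaired (λ a b → pair a (π₁ b)) m (pair k l))
                                              (cong (pair m) (π₁-pair k l))) c)
          ; (inj₂ c) → b′ (subst (Q′ x) (trans (unpaired (λ a b → pair a (π₂ b)) m (pair k l))
                                              (cong (pair m) (π₂-pair k l))) c) })
      (λ (i , c) →
        from (P⇔ x m) (π₁ i , λ a → c (inj₁
          (subst (P′ x) (sym (unpaired (λ a b → pair a (π₁ b)) m i)) a))) ,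
        from (Q⇔ x m) (π₂ i , λ b → c (inj₂
          (subst (Q′ x) (sym (unpaired (λ a b → pair a (π₂ b)) m i)) b))))

  Sg-∁ : ∀ n {P : Param S} → Sg S n P → Sg S (suc n) (λ x m → ¬ P x m)
  Sg-∁ n {P} p =
    _ , Sg-reparam n π₁ (π₁-rec id-rec) p ,
    λ x m → mk⇔ (λ a → 0 , subst (¬_ ∘ P x) (sym (π₁-pair m 0)) a)
                (λ (k , a) → subst (¬_ ∘ P x) (π₁-pair m k) a)

-- Effectively continuous maps

EffContinuous : (S T : Space) → (Carrier S → ℕ → Carrier T) → Set₁
EffContinuous S T φ = Open S (λ x m → Space.N T (π₁ m) (φ x (π₂ m)))

-- Effective continuity of (φ , β), a map to T × ℕ.
EffContinuous₂ : (S T : Space) → (Carrier S → ℕ → Carrier T) → (Carrier S → ℕ → ℕ) → Set₁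
EffContinuous₂ S T φ β =
  Open S (λ x m → Space.N T (π₁ (π₁ m)) (φ x (π₂ m)) × β x (π₂ m) ≡ π₂ (π₁ m))

Open-preimage : ∀ {S T P} φ β → EffContinuous₂ S T φ β → Open T P →
                Open S (λ x m → P (φ x m) (β x m))
Open-preimage {S} {T} {P} φ β Φ O = record
  -- Here `i` codes the value n of `β`, a stage at which a neighbourhood is enumerated into `P` at
  -- n, and a stage confirming that `φ` lies in that neighbourhood while `β` is n.
  { enum     = λ m i → e (enum O (π₁ i) (π₁ (π₂ i))) (π₁ i) m (π₂ (π₂ i))
  ; enum-rec =
      let i = var (suc zero)
          c = app₂ (enum O) (enum-rec O) (π₁-rec i) (π₁-rec (π₂-rec i)) in
      ifz-rec c (const-rec 0) (app₂ (enum Φ) (enum-rec Φ)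
        (pair-rec (pair-rec (pred-rec c) (π₁-rec i)) (var zero)) (π₂-rec (π₂-rec i)))
  ; enum⇔    = λ x m → mk⇔ (forth x m) (back x m)
  }
  where
  e : ℕ → ℕ → ℕ → ℕ → ℕ
  e c n m k = ifz c 0 (enum Φ (pair (pair (pred c) n) m) k)
  N-eq : ∀ x m s n →
         (Space.N T (π₁ (π₁ (pair (pair s n) m))) (φ x (π₂ (pair (pair s n) m))) ×
          β x (π₂ (pair (pair s n) m)) ≡ π₂ (π₁ (pair (pair s n) m))) ≡
         (Space.N T s (φ x m) × β x m ≡ n)
  N-eq x m s n = trans
    (unpaired (λ a m → Space.N T (π₁ a) (φ x m) × β x m ≡ π₂ a) (pair s n) m)
    (unpaired (λ s n → Space.N T s (φ x m) × β x m ≡ n) s n)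
  Enumerated : Carrier S → ℕ → Set
  Enumerated x m = ∃₂ λ i s →
    e (enum O (π₁ i) (π₁ (π₂ i))) (π₁ i) m (π₂ (π₂ i)) ≡ suc s × Space.N S s x
  forth : ∀ x m → P (φ x m) (β x m) → Enumerated x m
  forth x m a =
    let n = β x m
        (j , s , eq , b)    = to (enum⇔ O (φ x m) n) a
        (k , s′ , eq′ , c) = to (enum⇔ Φ x (pair (pair s n) m))
          (cast (sym (N-eq x m s n)) (b , refl))
    in pair n (pair j k) , s′ ,
       trans (unpaired (λ n i → e (enum O n (π₁ i)) n m (π₂ i)) n (pair j k))
         (trans (unpaired (λ j k → e (enum O n j) n m k) j k)
           (trans (cong (λ c → e c n m k) eq) eq′)) ,
       c
  back : ∀ x m → Enumerated x m → P (φ x m) (β x m)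
  back x m (i , s′ , eq′ , c) with enum O (π₁ i) (π₁ (π₂ i)) in eq
  back x m (i , s′ , () , c) | zero
  ... | suc s =
    let (b , β≡) = cast (N-eq x m s (π₁ i))
          (from (enum⇔ Φ x (pair (pair s (π₁ i)) m)) (π₂ (π₂ i) , s′ , eq′ , c))
    in subst (P (φ x m)) (sym β≡)
         (from (enum⇔ O (φ x m) (π₁ i)) (π₁ (π₂ i) , s , eq , b))

EffContinuous-×ℕ : ∀ {S T} φ → EffContinuous S T φ →
                   EffContinuous S (T ×ₛ ℕₛ) (λ x m → φ x (π₁ m) , π₂ m)
EffContinuous-×ℕ {S} {T} φ Φ = Sg-resp 0
  (λ x m → mk⇔
    (λ (d , a) → cast (eq x m) a , dist≡0⇒≡ _ _ d)
    (λ (a , d) → ≡⇒dist≡0 d , cast (sym (eq x m)) a))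
  -- The set { n } has index `suc n` in `ℕₛ`, so the condition on the number component is decidable.
  (Open-guard (λ m → dist (π₂ (π₁ m)) (suc (π₂ (π₂ m))))
    (dist-rec (π₂-rec (π₁-rec id-rec)) (suc-rec (π₂-rec (π₂-rec id-rec))))
    (Sg-reparam 0 (λ m → pair (π₁ (π₁ m)) (π₁ (π₂ m)))
      (pair-rec (π₁-rec (π₁-rec id-rec)) (π₁-rec (π₂-rec id-rec))) Φ))
  where
  eq : ∀ x m → _ ≡ _
  eq x m = unpaired (λ s m → Space.N T s (φ x m)) (π₁ (π₁ m)) (π₁ (π₂ m))

EffContinuous⇒₂ : ∀ {S T} φ b → Rec b → EffContinuous S T φ → EffContinuous₂ S T φ (λ _ → b)
EffContinuous⇒₂ {S} {T} φ b B Φ = Sg-resp 0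
  (λ x m → mk⇔
    (λ (d , a) → cast (eq x m) a , dist≡0⇒≡ _ _ d)
    (λ (a , d) → ≡⇒dist≡0 d , cast (sym (eq x m)) a))
  (Open-guard (λ m → dist (b (π₂ m)) (π₂ (π₁ m)))
    (dist-rec (app b B (π₂-rec id-rec)) (π₂-rec (π₁-rec id-rec)))
    (Sg-reparam 0 (λ m → pair (π₁ (π₁ m)) (π₂ m))
      (pair-rec (π₁-rec (π₁-rec id-rec)) (π₂-rec id-rec)) Φ))
  where
  eq : ∀ x m → _ ≡ _
  eq x m = unpaired (λ s m → Space.N T s (φ x m)) (π₁ (π₁ m)) (π₂ m)

-- Induction replaces `T` by `T ×ₛ ℕₛ` while `S` stays fixed: the quantified number joins the
-- parameter. This is why the statement is about preimages under an arbitrary `φ`.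
Σ⁰⇒Sg : ∀ n {S T A} φ → EffContinuous S T φ → Σ⁰ (suc n) T A → Sg S n (λ x m → A (φ x m))
Σ⁰⇒Sg zero {S} {T} {A} φ Φ (union ε E A≐) =
  Open-preimage {S} {T} {λ y _ → A y} φ (λ _ m → m)
    (EffContinuous⇒₂ {S} {T} φ (λ m → m) id-rec Φ) record
    { enum     = λ _ j → suc (ε (j ∷ []))
    ; enum-rec = suc-rec (comp {g = λ _ v → lookup v (suc zero)} E (λ _ → var (suc zero))
                               (λ _ → refl))
    ; enum⇔    = λ y _ → mk⇔
        (λ a → let (n , b) = proj₁ A≐ a in n , _ , refl , b)
        (λ { (n , _ , refl , b) → proj₂ A≐ (n , b) })
    }
Σ⁰⇒Sg (suc n) {S} {T} {A} φ Φ (proj B (compl B′ σ B≐) A≐) =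
  (λ x m → B′ (φ x (π₁ m) , π₂ m)) ,
  Σ⁰⇒Sg n _ (EffContinuous-×ℕ {S} {T} φ Φ) σ , λ x m → mk⇔
    (λ a → let (k , b) = proj₁ A≐ a in
      k , subst ¬_ (sym (unpaired (λ m k → B′ (φ x m , k)) m k)) (proj₁ B≐ b))
    (λ (k , b) → proj₂ A≐
      (k , proj₂ B≐ (subst ¬_ (unpaired (λ m k → B′ (φ x m , k)) m k) b)))

-- Conversely, quantified numbers leave the parameter and become factors `ℕₛ` of the space. `N T 0`
-- has to be empty since `union` lists a neighbourhood at every stage and `pred` sends the value 0
-- to the index 0.
Sg⇒Σ⁰ : ∀ n {S T P} (α : Carrier T → Carrier S) (β : Carrier T → ℕ) → (∀ t → ¬ Space.N T 0 t) →
        EffContinuous₂ T S (λ t _ → α t) (λ t _ → β t) →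
        Sg S n P → Σ⁰ (suc n) T (λ t → P (α t) (β t))
Sg⇒Σ⁰ zero {S} {T} {P} α β ∅ Φ O =
  union (λ v → pred (enum O′ 0 (lookup v zero)))
    (pred-rec (app₂ (enum O′) (enum-rec O′) (const-rec 0) (var zero)))
    ((λ {t} a → let (j , s , eq , b) = to (enum⇔ O′ t 0) a in
       j , subst (λ s → Space.N T s t) (sym (cong pred eq)) b) ,
     (λ {t} (j , b) → from (enum⇔ O′ t 0) (j , back t j b)))
  where
  O′ : Open T (λ t _ → P (α t) (β t))
  O′ = Open-preimage {T} {S} {P} (λ t _ → α t) (λ t _ → β t) Φ O
  back : ∀ t j → Space.N T (pred (enum O′ 0 j)) t →
         ∃ λ s → enum O′ 0 j ≡ suc s × Space.N T s t
  back t j b with enum O′ 0 j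
  ... | zero  = contradiction b (∅ t)
  ... | suc s = s , refl , b
Sg⇒Σ⁰ (suc n) {S} {T} {P} α β ∅ Φ (Q , q , P⇔) =
  proj _
    (compl _
      (Sg⇒Σ⁰ n {S} {T ×ₛ ℕₛ} {Q} (λ (t , _) → α t) (λ (t , k) → pair (β t) k)
        (λ { _ (_ , ()) }) Φ′ q)
      ((λ b → b) , (λ b → b)))
    ((λ {t} → to (P⇔ (α t) (β t))) , (λ {t} → from (P⇔ (α t) (β t))))
  where
  Φ′ : EffContinuous₂ (T ×ₛ ℕₛ) S (λ (t , _) _ → α t) (λ (t , k) _ → pair (β t) k)
  Φ′ = Sg-resp 0
    (λ (t , k) m → mk⇔
      (λ (a , k≡) → let (b , β≡) = cast (eq t m) a in
        b , trans (cong₂ pair β≡ k≡) (pair-unpair (π₂ (π₁ m))))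
      (λ (b , eq′) → cast (sym (eq t m))
        (b , trans (sym (π₁-pair (β t) k)) (cong π₁ eq′)) ,
        trans (sym (π₂-pair (β t) k)) (cong π₂ eq′)))
    (record
      -- The value wanted for `pair (β t) k` splits in two: the first component is passed to `Φ`,
      -- and the second is enforced by a singleton neighbourhood of `ℕₛ`.
      { enum     = λ m j → ifz (e m j) 0 (suc (pair (pred (e m j)) (suc (π₂ (π₂ (π₁ m))))))
      ; enum-rec = ifz-rec e-rec (const-rec 0)
          (suc-rec (pair-rec (pred-rec e-rec) (suc-rec (π₂-rec (π₂-rec (π₁-rec (var zero)))))))
      ; enum⇔    = λ (t , k) m → mk⇔
          (λ (a , k≡) → let (j , s , eq , b) = to (enum⇔ Φ t (h m)) a in
            j , _ , cong (λ c → ifz c 0 (suc (pair (pred c) _))) eq ,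
            subst (λ s → Space.N T s t) (sym (π₁-pair s _)) b ,
            trans (π₂-pair s _) (cong suc (sym k≡)))
          (back t k m)
      })
    where
    h : ℕ → ℕ
    h m = pair (pair (π₁ (π₁ m)) (π₁ (π₂ (π₁ m)))) (π₂ m)
    eq : ∀ t m → _ ≡ _
    eq t m = trans
      (unpaired (λ a _ → Space.N S (π₁ a) (α t) × β t ≡ π₂ a)
        (pair (π₁ (π₁ m)) (π₁ (π₂ (π₁ m)))) (π₂ m))
      (unpaired (λ s n → Space.N S s (α t) × β t ≡ n) (π₁ (π₁ m)) (π₁ (π₂ (π₁ m))))
    e : ℕ → ℕ → ℕ
    e m j = enum Φ (h m) j
    e-rec : Rec₂ e
    e-rec = app₂ (enum Φ) (enum-rec Φ)
      (pair-rec (pair-rec (π₁-rec (π₁-rec (var zero))) (π₁-rec (π₂-rec (π₁-rec (var zero)))))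
                (π₂-rec (var zero)))
      (var (suc zero))
    R : Param T
    R t m = Space.N S (π₁ (π₁ m)) (α t) × β t ≡ π₂ (π₁ m)
    back : ∀ t k m →
      (∃₂ λ j s → ifz (e m j) 0 (suc (pair (pred (e m j)) (suc (π₂ (π₂ (π₁ m)))))) ≡ suc s ×
                  Space.N (T ×ₛ ℕₛ) s (t , k)) →
      R t (h m) × k ≡ π₂ (π₂ (π₁ m))
    back t k m (j , s , _    , _) with e m j in eq
    back t k m (j , s , ()   , _) | zero
    back t k m (j , _ , refl , b , k≡) | suc s =
      from (enum⇔ Φ t (h m)) (j , s , eq , subst (λ s → Space.N T s t) (π₁-pair s _) b) ,
      sym (ℕₚ.suc-injective (trans (sym (π₂-pair s _)) k≡))

-- Coordinates of a pair of sequences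

side : ∀ {A : Set} → Bool → A × A → A
side true  = proj₁
side false = proj₂

module _ (X : Space) where

  open Space X using (N)

  -- The coordinates must be distinct, as two basic neighbourhoods of the same
  -- coordinate need not contain a common one.
  EffContinuous-coordinates :
    (∀ x → ∃ λ s → N s x) →
    ∀ b c p q → Rec p → Rec q → (∀ m → ¬ (b ≡ c × p m ≡ q m)) →
    EffContinuous (X ^ℕ ×ₛ X ^ℕ) (X ×ₛ X) (λ w m → side b w (p m) , side c w (q m))
  EffContinuous-coordinates covered b c p q p-rec q-rec distinct =
    Sg-resp 0 (λ w m → mk⇔
        (λ (k , a) → back w (π₁ m) (π₂ m) k (cast (unpaired (Coded w) m k) a))
        (λ a → let (k , d) = forth w (π₁ m) (π₂ m) a in
          k , cast (sym (unpaired (Coded w) m k)) d))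
      -- The search is over two codes of lists of neighbourhoods, one for each sequence. The guard
      -- prescribes the entries at `p i` and `q i` and leaves all others free.
      (Sg-∃ 0 (Open-guard (λ x → mismatch (π₁ (π₁ x)) (π₂ (π₁ x)) (π₂ x))
        (+-rec (dist-rec (entry-rec (code-rec b) (app p p-rec i-rec)) (π₁-rec s-rec))
               (dist-rec (entry-rec (code-rec c) (app q q-rec i-rec)) (π₂-rec s-rec)))
        (Sg-reparam 0 (λ x → box (π₂ (π₁ x)) (π₂ x))
          (pair-rec (pair-rec len-rec (π₁-rec (π₂-rec id-rec)))
                    (pair-rec len-rec (π₂-rec (π₂-rec id-rec))))
          Open-N)))
    where
    W : Space
    W = X ^ℕ ×ₛ X ^ℕ

    code : Bool → ℕ → ℕ
    code σ k = side σ (unpair k)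

    mismatch : ℕ → ℕ → ℕ → ℕ
    mismatch s i k =
      dist (entry (code b k) (p i)) (π₁ s) + dist (entry (code c k) (q i)) (π₂ s)

    len : ℕ → ℕ
    len i = suc (p i + q i)

    box : ℕ → ℕ → ℕ
    box i k = pair (pair (len i) (π₁ k)) (pair (len i) (π₂ k))

    Coded : Carrier W → ℕ → ℕ → Set
    Coded w m k = mismatch (π₁ m) (π₂ m) k ≡ 0 × Space.N W (box (π₂ m) k) w

    code-rec : ∀ σ → Rec (λ x → code σ (π₂ x))
    code-rec true  = π₁-rec (π₂-rec id-rec)
    code-rec false = π₂-rec (π₂-rec id-rec)

    s-rec : Rec (λ x → π₁ (π₁ x))
    s-rec = π₁-rec (π₁-rec id-rec)

    i-rec : Rec (λ x → π₂ (π₁ x))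
    i-rec = π₂-rec (π₁-rec id-rec)

    len-rec : Rec (λ x → len (π₂ (π₁ x)))
    len-rec = suc-rec (+-rec (app p p-rec i-rec) (app q q-rec i-rec))

    Box : ℕ → ℕ → (ℕ → Carrier X) → Set
    Box l c x = ∀ j → j < l → N (entry c j) (x j)

    box≡ : ∀ w i k → Space.N W (box i k) w ≡
           (Box (len i) (π₁ k) (proj₁ w) × Box (len i) (π₂ k) (proj₂ w))
    box≡ (x , y) i k = trans
      (unpaired (λ s t → Space.N (X ^ℕ) s x × Space.N (X ^ℕ) t y)
        (pair (len i) (π₁ k)) (pair (len i) (π₂ k)))
      (cong₂ _×_ (unpaired (λ l c → Box l c x) (len i) (π₁ k))
                 (unpaired (λ l c → Box l c y) (len i) (π₂ k)))

    back : ∀ w s i k → mismatch s i k ≡ 0 × Space.N W (box i k) w →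
           N (π₁ s) (side b w (p i)) × N (π₂ s) (side c w (q i))
    back w s i k (z , a) =
      subst (λ s → N s _) (dist≡0⇒≡ _ _ (ℕₚ.m+n≡0⇒m≡0 (dist _ (π₁ s)) z))
        (at b (p i) (s≤s (ℕₚ.m≤m+n (p i) (q i)))) ,
      subst (λ s → N s _) (dist≡0⇒≡ _ _ (ℕₚ.m+n≡0⇒n≡0 (dist _ (π₁ s)) z))
        (at c (q i) (s≤s (ℕₚ.m≤n+m (q i) (p i))))
      where
      at : ∀ σ j → j < len i → N (entry (code σ k) j) (side σ w j)
      at true  = proj₁ (cast (box≡ w i k) a)
      at false = proj₂ (cast (box≡ w i k) a)

    forth : ∀ w s i → N (π₁ s) (side b w (p i)) × N (π₂ s) (side c w (q i)) →
            ∃ λ k → mismatch s i k ≡ 0 × Space.N W (box i k) w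
    forth w s i (a , a′) =
      k ,
      cong₂ _+_
        (≡⇒dist≡0 (trans (code-entry b (p i) (s≤s (ℕₚ.m≤m+n (p i) (q i))))
          (proj₁ (proj₂ (proj₂ (target b (p i)))) (refl , refl))))
        (≡⇒dist≡0 (trans (code-entry c (q i) (s≤s (ℕₚ.m≤n+m (q i) (p i))))
          (proj₂ (proj₂ (proj₂ (target c (q i)))) (refl , refl)))) ,
      cast (sym (box≡ w i k)) (inside true , inside false)
      where
      -- The prescribed neighbourhoods at the two chosen coordinates, and one supplied by `covered`
      -- at every other; `distinct` rules out a clash.
      target : ∀ σ j → ∃ λ t → N t (side σ w j) ×
               (b ≡ σ × p i ≡ j → t ≡ π₁ s) × (c ≡ σ × q i ≡ j → t ≡ π₂ s)
      target σ j with (b Boolₚ.≟ σ) ×-dec (p i ℕₚ.≟ j) | (c Boolₚ.≟ σ) ×-dec (q i ℕₚ.≟ j)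
      ... | yes (refl , refl) | _ = π₁ s , a , (λ _ → refl) ,
        λ (c≡ , q≡) → contradiction (sym c≡ , sym q≡) (distinct i)
      ... | no ≢ | yes (refl , refl) =
        π₂ s , a′ , (λ p≡ → contradiction p≡ ≢) , (λ _ → refl)
      ... | no ≢ | no ≢′ = let (t , a) = covered _ in
        t , a , (λ p≡ → contradiction p≡ ≢) , (λ q≡ → contradiction q≡ ≢′)

      κ : ∀ σ → ∃ λ c → ∀ j → j < len i → entry c j ≡ proj₁ (target σ j)
      κ σ = entry-surjective (λ j → proj₁ (target σ j)) (len i)

      k : ℕ
      k = pair (proj₁ (κ true)) (proj₁ (κ false))

      code≡ : ∀ σ → code σ k ≡ proj₁ (κ σ)
      code≡ true  = π₁-pair (proj₁ (κ true)) (proj₁ (κ false))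
      code≡ false = π₂-pair (proj₁ (κ true)) (proj₁ (κ false))

      code-entry : ∀ σ j → j < len i → entry (code σ k) j ≡ proj₁ (target σ j)
      code-entry σ j j< = trans (cong (λ c → entry c j) (code≡ σ)) (proj₂ (κ σ) j j<)

      inside : ∀ σ j → j < len i → N (entry (code σ k) j) (side σ w j)
      inside σ j j< = subst (λ t → N t (side σ w j)) (sym (code-entry σ j j<))
        (proj₁ (proj₂ (target σ j)))

-- Balls of radius 1/(n+1)

ε⟨_⟩ : ℕ → ℚ
ε⟨ n ⟩ = + 1 ℚ./ suc n

archimedean : ∀ ε → 0ℚ ℚ.< ε → ∃ λ n → ε⟨ n ⟩ ℚ.< ε
-- Here ε is (a + 1)/(b + 1), which exceeds 1/(b + 2).
archimedean ε@(mkℚ (+ suc a) b _) _ = suc b , ℚₚ.toℚᵘ-cancel-<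
  (ℚᵘₚ.<-respˡ-≃ (ℚᵘₚ.≃-sym (ℚₚ.toℚᵘ-fromℚᵘ (mkℚᵘ (+ 1) (suc b))))
    (*<* (ℤ.+<+ (subst₂ _<_ (sym (ℕₚ.*-identityˡ (suc b))) refl
      (ℕₚ.<-≤-trans (ℕₚ.n<1+n (suc b)) (ℕₚ.m≤m+n (suc (suc b)) _))))))
archimedean (mkℚ (+ zero) b _) (ℚ.*<* (ℤ.+<+ ()))
archimedean (mkℚ -[1+ a ] b _) (ℚ.*<* ())

archimedean₂ : ∀ ε → 0ℚ ℚ.< ε → ∃ λ n → ε⟨ n ⟩ ℚ.+ ε⟨ n ⟩ ℚ.< ε
archimedean₂ ε 0<ε =
  let (n , lt) = archimedean (½ ℚ.* ε)
        (subst (ℚ._< ½ ℚ.* ε) (ℚₚ.*-zeroʳ ½) (ℚₚ.*-monoʳ-<-pos ½ 0<ε))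
  in n , subst (ε⟨ n ⟩ ℚ.+ ε⟨ n ⟩ ℚ.<_)
           (trans (sym (ℚₚ.*-distribʳ-+ ε ½ ½)) (ℚₚ.*-identityˡ ε))
           (ℚₚ.+-mono-< lt lt)

module _ (X : RecursivePolishSpace) where

  open RecursivePolishSpace X using (_≈_; d; isMetric; dense; r)
  open Space (space X) using (N)
  open IsGeneralMetric isMetric using (0⇒≈; nonNegative)
    renaming (sym to d-sym; triangle to d-triangle)

  ball : ℕ → ℕ → ℕ
  ball k n = pair k (pair 1 (pair n 0))

  N-ball : ∀ x k n → N (ball k n) x ≡ (d x (r k) <ℚ ε⟨ n ⟩)
  N-ball x k n
    rewrite π₁-pair k (pair 1 (pair n 0)) | π₂-pair k (pair 1 (pair n 0))
          | π₁-pair 1 (pair n 0) | π₂-pair 1 (pair n 0) | π₁-pair n 0 = refl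

  near : ∀ x n → ∃ λ k → N (ball k n) x
  near x n = let (k , lt) = dense x ε⟨ n ⟩ (ℚₚ.positive⁻¹ ε⟨ n ⟩ ⦃ ℚₚ.normalize-pos 1 (suc n) ⦄) in
    k , cast (sym (N-ball x k n)) lt

  covered : ∀ x → ∃ λ s → N s x
  covered x = let (k , a) = near x 0 in ball k 0 , a

  -- Equality is the intersection of these open sets over all n, hence `Π⁰ 2`.
  Close : Param (space X ×ₛ space X)
  Close (x , y) n = ∃ λ k → N (ball k n) x × N (ball k n) y

  Close⇒≈ : ∀ x y → (∀ n → Close (x , y) n) → x ≈ y
  Close⇒≈ x y close = 0⇒≈ (((λ {p} → below p) , λ {ε} → small ε) , nonNegative)
    where
    small : ∀ ε → 0ℚ ℚ.< ε → upper (d x y) ε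
    small ε 0<ε =
      let (n , 2ε<ε)  = archimedean₂ ε 0<ε
          (k , a , b) = close n
      in proj₂ (d-triangle x (r k) y)
           (ε⟨ n ⟩ , ε⟨ n ⟩ , cast (N-ball x k n) a ,
            proj₂ (proj₁ (d-sym (r k) y)) (cast (N-ball y k n) b) , 2ε<ε)
    below : ∀ p → lower (d x y) p → p ℚ.< 0ℚ
    below p l with p ℚₚ.<? 0ℚ
    ... | yes p<0 = p<0
    ... | no  p≮0 =
      let (q , p<q , l′) = ℝ.lower-open (d x y) l in
      contradiction (ℝ.ordered (d x y) l′ (small q (ℚₚ.≤-<-trans (ℚₚ.≮⇒≥ p≮0) p<q)))
                    (ℚₚ.<-irrefl refl)

  ≈⇒Close : ∀ x y → x ≈ y → ∀ n → Close (x , y) n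
  ≈⇒Close x y x≈y n = let (k , a) = near x n in
    k , a , Space.N-resp (space X) (ball k n) x≈y a

  Open-Close : Open (space X ×ₛ space X) Close
  Open-Close = record
    { enum     = λ n k → suc (pair (ball k n) (ball k n))
    ; enum-rec = let b = pair-rec (var (suc zero)) (pair-rec (const-rec 1)
                           (pair-rec (var zero) (const-rec 0)))
                 in suc-rec (pair-rec b b)
    ; enum⇔    = λ (x , y) n → mk⇔
        (λ (k , a) → k , _ , refl , cast (sym (eq x y n k)) a)
        (λ { (k , _ , refl , a) → k , cast (eq x y n k) a })
    }
    where
    eq : ∀ x y n k → _ ≡ _
    eq x y n k = unpaired (λ s t → N s x × N t y) (ball k n) (ball k n)

-- Dual families and the class `∀ᴺ Γ`

EffContinuous₂-×ℕ : ∀ {S} → EffContinuous₂ (S ×ₛ ℕₛ) S (λ (x , _) _ → x) (λ (_ , k) _ → k)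
EffContinuous₂-×ℕ {S} = record
  { enum     = λ m _ → suc (pair (π₁ (π₁ m)) (suc (π₂ (π₁ m))))
  ; enum-rec = suc-rec (pair-rec (π₁-rec (π₁-rec (var zero)))
                                 (suc-rec (π₂-rec (π₁-rec (var zero)))))
  ; enum⇔    = λ (x , k) m → mk⇔
      (λ (a , k≡) → 0 , _ , refl , cast (sym (eq x k m)) (a , cong suc (sym k≡)))
      (λ { (_ , _ , refl , a) → let (a , k≡) = cast (eq x k m) a in
           a , sym (ℕₚ.suc-injective k≡) })
  }
  where
  eq : ∀ x k m → _ ≡ _
  eq x k m = unpaired (λ s t → Space.N S s x × t ≡ suc k) (π₁ (π₁ m)) (suc (π₂ (π₁ m)))

-- The k for which ∀ᴺ Γ = Π⁰ₖ₊₂, as ∀ᴺ Σ⁰ₙ = Π⁰ₙ₊₁ and ∀ᴺ Π⁰ₙ = Π⁰ₙ.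
dualLevel : ∀ {Γ} → IsLightface Γ → ℕ
dualLevel (sigma {zero} ())
dualLevel (sigma {suc n} _) = n
dualLevel (pi {suc zero} (s≤s ()))
dualLevel (pi {suc (suc n)} _) = n

module _ (em : ExcludedMiddle 0ℓ) where

  private
    dne : ∀ {A : Set} → ¬ ¬ A → A
    dne = em⇒dne em

    ¬∀⇒∃¬ : ∀ {A : Set} {P : A → Set} → ¬ (∀ a → P a) → ∃ λ a → ¬ P a
    ¬∀⇒∃¬ ¬∀ = dne λ ¬∃ → ¬∀ λ a → dne λ ¬p → ¬∃ (a , ¬p)

  module _ {S : Space} where

    -- Each level is reached by complementing the one before. Both hypotheses start the induction,
    -- as Σ⁰₁ sets of an arbitrary `Space` need not be Σ⁰₂.
    Sg-Δ : ∀ n {P : Param S} → Sg S 0 P → Sg S 1 P →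
           Sg S (suc n) P × Sg S (suc n) (λ x m → ¬ P x m)
    Sg-Δ zero    p₀ p₁ = p₁ , Sg-∁ 0 p₀
    Sg-Δ (suc n) p₀ p₁ = let (p , ¬p) = Sg-Δ n p₀ p₁ in
      Sg-resp (suc (suc n)) (λ x m → mk⇔ dne contradiction) (Sg-∁ (suc n) ¬p) ,
      Sg-∁ (suc n) p

    -- The uniformly Π⁰ₙ₊₁ families, represented by their complements.
    Pg : ℕ → Param S → Set₁
    Pg n P = Sg S n (λ x m → ¬ P x m)

    Pg-∩ : ∀ n {P Q} → Pg n P → Pg n Q → Pg n (λ x m → P x m × Q x m)
    Pg-∩ n p q = Sg-resp n
      (λ x m → mk⇔ (λ { (inj₁ ¬a) (a , _) → ¬a a ; (inj₂ ¬b) (_ , b) → ¬b b })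
                   (λ ¬ab → dne λ ¬∪ → ¬∪ (inj₁ λ a → ¬∪ (inj₂ λ b → ¬ab (a , b)))))
      (Sg-∪ n p q)

    Pg-∪ : ∀ n {P Q} → Pg (suc n) P → Pg (suc n) Q → Pg (suc n) (λ x m → P x m ⊎ Q x m)
    Pg-∪ n p q = Sg-resp (suc n)
      (λ x m → mk⇔ (λ { (¬a , ¬b) (inj₁ a) → ¬a a ; (¬a , ¬b) (inj₂ b) → ¬b b })
                   (λ ¬∪ → ¬∪ ∘ inj₁ , ¬∪ ∘ inj₂))
      (Sg-∩ n p q)

    Pg-∀ : ∀ n {P} → Pg n P → Pg n (λ x _ → ∀ m → P x m)
    Pg-∀ n {P} p = Sg-resp n
      (λ x m → mk⇔ (λ (k , ¬a) ∀a → ¬a (∀a (π₂ (pair m k))))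
                   (λ ¬∀ → let (k , ¬a) = ¬∀⇒∃¬ ¬∀ in
                     k , subst (¬_ ∘ P x) (sym (π₂-pair m k)) ¬a))
      (Sg-∃ n (Sg-reparam n π₂ (π₂-rec id-rec) p))

  -- Σ⁰ₙ lies in Π⁰ₙ₊₁ by a vacuous quantifier, and Π⁰ₙ keeps its level.
  Γ⇒Pg : ∀ {Γ} (lf : IsLightface Γ) {S T A} φ → EffContinuous S T φ → Γ T A →
         Pg {S} (suc (dualLevel lf)) (λ x m → A (φ x m))
  Γ⇒Pg (sigma {zero} ())
  Γ⇒Pg (sigma {suc n} _) {S} {T} φ Φ a = Sg-∁ n (Σ⁰⇒Sg n {S} {T} φ Φ a)
  Γ⇒Pg (pi {suc zero} (s≤s ()))
  Γ⇒Pg (pi {suc (suc n)} _) {S} {T} φ Φ (compl B b A≐) = Sg-resp (suc n)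
    (λ x m → mk⇔ (λ b a → proj₁ A≐ a b) (λ ¬a → dne λ ¬b → ¬a (proj₂ A≐ ¬b)))
    (Σ⁰⇒Sg (suc n) {S} {T} φ Φ b)

  -- For Σ⁰ₙ, the leading existential quantifier of the complement becomes the universal one in
  -- front of a Σ⁰ₙ set; for Π⁰ₙ the universal quantifier is vacuous.
  Pg⇒∀ᴺ : ∀ {Γ} (lf : IsLightface Γ) {S A} →
          Pg {S} (suc (dualLevel lf)) (λ x _ → A x) → ∀ᴺ Γ S A
  Pg⇒∀ᴺ (sigma {zero} ())
  Pg⇒∀ᴺ (sigma {suc n} _) {S} (Q , q , ¬A⇔) =
    (λ (x , k) → Q x (pair 0 k)) ,
    Sg⇒Σ⁰ n {S} {S ×ₛ ℕₛ} {λ x k → Q x (pair 0 k)} proj₁ proj₂ (λ { _ (_ , ()) })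
      (EffContinuous₂-×ℕ {S}) (Sg-reparam n (pair 0) (pair-rec (const-rec 0) id-rec) q) ,
    (λ {x} a k → dne λ ¬b → from (¬A⇔ x 0) (k , ¬b) a) ,
    (λ {x} b → dne λ ¬a → let (k , ¬b) = to (¬A⇔ x 0) ¬a in ¬b (b k))
  Pg⇒∀ᴺ (pi {suc zero} (s≤s ()))
  Pg⇒∀ᴺ (pi {suc (suc n)} _) {S} {A} ¬a =
    (λ (x , _) → A x) ,
    compl _ (Sg⇒Σ⁰ (suc n) {S} {S ×ₛ ℕₛ} {λ x _ → ¬ A x} proj₁ proj₂ (λ { _ (_ , ()) })
      (EffContinuous₂-×ℕ {S}) ¬a) (contradiction , dne) ,
    (λ a _ → a) , (λ a → a 0)

-- Invariance of lightface sets under `≈`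

mutual
  Σ⁰-resp-≈ : ∀ {n S A} → Σ⁰ n S A → ∀ {x y} → Space._≈_ S x y → A x → A y
  Σ⁰-resp-≈ {S = S} (union ε _ A≐) x≈y a =
    let (n , b) = proj₁ A≐ a in proj₂ A≐ (n , Space.N-resp S _ x≈y b)
  Σ⁰-resp-≈ {S = S} (proj B b A≐) x≈y a =
    let (m , c) = proj₁ A≐ a in proj₂ A≐ (m , Π⁰-resp-≈ b (x≈y , refl) c)

  Π⁰-resp-≈ : ∀ {n S A} → Π⁰ n S A → ∀ {x y} → Space._≈_ S x y → A x → A y
  Π⁰-resp-≈ {S = S} (compl B b A≐) x≈y a =
    proj₂ A≐ λ c → proj₁ A≐ a (Σ⁰-resp-≈ b (IsEquivalence.sym (Space.isEquivalence S) x≈y) c)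

-- A graphing is not assumed to respect `≈`; this follows from its membership in Γ.
Γ-resp-≈ : ∀ {Γ} → IsLightface Γ → ∀ {S A} → Γ S A → ∀ {x y} → Space._≈_ S x y → A x → A y
Γ-resp-≈ (sigma _) = Σ⁰-resp-≈
Γ-resp-≈ (pi _)    = Π⁰-resp-≈

∀ᴺ-resp-≈ : ∀ {Γ} → IsLightface Γ → ∀ {S A} → ∀ᴺ Γ S A →
            ∀ {x y} → Space._≈_ S x y → A x → A y
∀ᴺ-resp-≈ lf (B , b , A≐) x≈y a = proj₂ A≐ λ m → Γ-resp-≈ lf b (x≈y , refl) (proj₁ A≐ a m)

-- The graphing of the jump

module JumpGraph (S : Space) (G : Rel (Carrier S) 0ℓ) where

  open Space S using (_≈_)

  infix 4 _~_

  _~_ : Rel (Carrier S) 0ℓ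
  x ~ y = G x y ⊎ x ≈ y

  -- Row 0 is reserved for the mark: the interpolating vertices are constant on it.
  Marked : Carrier (S ^ℕ) → Set
  Marked z = z (pair 0 0) ≈ z (pair 0 1)

  Parallel : Rel (Carrier (S ^ℕ)) 0ℓ
  Parallel x z = ∀ i → x i ~ z i

  -- An entry z (pair c (pair j k)) other than z (pair l 0) is a bit asserting
  -- that z j ~ x k.
  Coding : ℕ → ℕ → Rel (Carrier (S ^ℕ)) 0ℓ
  Coding l c x z =
    (∀ i → x i ~ z (pair l i)) ×
    (∀ j → ∃ λ k → ¬ z (pair c (pair j k)) ≈ z (pair l 0)) ×
    (∀ m → z (pair c m) ≈ z (pair l 0) ⊎ z (π₁ m) ~ x (π₂ m))

  -- Separate rows for the two ends of a path: when it has length 2, its one middle vertex must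
  -- carry codes relative to both.
  Coding₁ Coding₂ Linked Core Edge : Rel (Carrier (S ^ℕ)) 0ℓ
  Coding₁ = Coding 1 3
  Coding₂ = Coding 2 4
  Linked x z = Parallel x z ⊎ (Coding₁ x z ⊎ Coding₂ x z) ⊎ (Coding₁ z x ⊎ Coding₂ z x)
  Core x z   = (Marked x ⊎ Marked z) × Linked x z
  Edge x z   = Core x z × ¬ (∀ i → x i ≈ z i)

-- Complexity of the edge relation

pair-row-injective : ∀ {l c i j} → pair l i ≡ pair c j → l ≡ c
pair-row-injective {l} {c} {i} {j} eq =
  trans (sym (π₁-pair l i)) (trans (cong π₁ eq) (π₁-pair c j))

module _ (em : ExcludedMiddle 0ℓ) {Γ : Pointclass} (lf : IsLightface Γ)
         (X : RecursivePolishSpace)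
         {_≺_ : Rel (Carrier (space X)) 0ℓ}
         (≺-order : IsStrictTotalOrder (Space._≈_ (space X)) _≺_)
         (≺-Σ⁰₁ : Σ⁰ 1 (space X ×ₛ space X) (uncurry _≺_))
         {G : Rel (Carrier (space X)) 0ℓ}
         (G-Γ : Γ (space X ×ₛ space X) (uncurry G)) where

  open JumpGraph (space X) G
  open RecursivePolishSpace X using (_≈_)

  private
    W : Space
    W = space X ^ℕ ×ₛ space X ^ℕ

    n : ℕ
    n = dualLevel lf

    P : Param W → Set₁
    P = Pg em {W} (suc n)

  module _ (b c : Bool) (p q : ℕ → ℕ) (p-rec : Rec p) (q-rec : Rec q)
           (distinct : ∀ m → ¬ (b ≡ c × p m ≡ q m)) where

    private
      At : Rel (Carrier (space X)) 0ℓ → Param W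
      At R w m = R (side b w (p m)) (side c w (q m))

      Apart : Rel (Carrier (space X)) 0ℓ
      Apart x y = ¬ x ≈ y

    apart-Sg₀ : Sg W 0 (At Apart)
    apart-Sg₀ = Sg-resp 0
      (λ w m → mk⇔ (λ { (inj₁ x≺y) x≈y → irrefl x≈y x≺y
                      ; (inj₂ y≺x) x≈y → irrefl (Eq.sym x≈y) y≺x })
                   (separate (side b w (p m)) (side c w (q m))))
      (Sg-∪ 0
        (Σ⁰⇒Sg 0 {W} _
          (EffContinuous-coordinates (space X) (covered X) b c p q p-rec q-rec distinct) ≺-Σ⁰₁)
        (Σ⁰⇒Sg 0 {W} _
          (EffContinuous-coordinates (space X) (covered X) c b q p q-rec p-rec
            (λ m (c≡b , q≡p) → distinct m (sym c≡b , sym q≡p))) ≺-Σ⁰₁))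
      where
      open IsStrictTotalOrder ≺-order using (compare; irrefl; module Eq)
      separate : ∀ x y → ¬ x ≈ y → x ≺ y ⊎ y ≺ x
      separate x y x≉y with compare x y
      ... | tri< x≺y _ _ = inj₁ x≺y
      ... | tri≈ _ x≈y _ = contradiction x≈y x≉y
      ... | tri> _ _ y≺x = inj₂ y≺x

    -- Two points differ iff they fail to be `Close` at some scale, and `Close` is open.
    apart-Sg₁ : Sg W 1 (At Apart)
    apart-Sg₁ = C ,
      Open-preimage {W} {space X ×ₛ space X} {Close X} φ (λ _ → π₂)
        (EffContinuous⇒₂ {W} {space X ×ₛ space X} φ π₂ (π₂-rec id-rec)
          (EffContinuous-coordinates (space X) (covered X) b c (p ∘ π₁) (q ∘ π₁)
            (app p p-rec (π₁-rec id-rec)) (app q q-rec (π₁-rec id-rec))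
            (λ m → distinct (π₁ m))))
        (Open-Close X) ,
      λ w m → mk⇔
        (λ x≉y → em⇒dne em λ ¬∃ → x≉y (Close⇒≈ X _ _ λ k → em⇒dne em λ ¬close →
          ¬∃ (k , subst ¬_ (sym (eq w m k)) ¬close)))
        (λ (k , ¬close) x≈y → subst ¬_ (eq w m k) ¬close (≈⇒Close X _ _ x≈y k))
      where
      φ : Carrier W → ℕ → Carrier (space X ×ₛ space X)
      φ w m = side b w (p (π₁ m)) , side c w (q (π₁ m))
      C : Param W
      C w m = Close X (φ w m) (π₂ m)
      eq : ∀ w m k → C w (pair m k) ≡ Close X (side b w (p m) , side c w (q m)) k
      eq w = unpaired (λ m k → Close X (side b w (p m) , side c w (q m)) k)

    ≈-Pg : P (At _≈_)
    ≈-Pg = proj₁ (Sg-Δ em n apart-Sg₀ apart-Sg₁)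

    -- The quantifier is absorbed at the levels 0 and 1, before `Sg-Δ` is applied: in front of a
    -- family known only to be in `P`, it would raise the class.
    ∃-apart-Pg : P (λ w m → ∃ λ k → At Apart w (pair m k))
    ∃-apart-Pg = proj₂ (Sg-Δ em n (Sg-∃ 0 apart-Sg₀) (Sg-∃ 1 apart-Sg₁))

    ~-Pg : P (At _~_)
    ~-Pg = Pg-∪ em n
      (Γ⇒Pg em lf {W} {space X ×ₛ space X} _
        (EffContinuous-coordinates (space X) (covered X) b c p q p-rec q-rec distinct) G-Γ)
      ≈-Pg

  Marked-Pg : ∀ b → P (λ w _ → Marked (side b w))
  Marked-Pg b = ≈-Pg b b (λ _ → pair 0 0) (λ _ → pair 0 1) (const-rec _) (const-rec _)
    (λ { _ (_ , ()) })

  Coding-Pg : ∀ b l c → ¬ c ≡ l → P (λ w _ → Coding l c (side b w) (side (not b) w))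
  Coding-Pg b l c c≢l =
    Pg-∩ em (suc n)
      (Pg-∀ em (suc n) (~-Pg b (not b) (λ i → i) (pair l) id-rec (pair-rec (const-rec l) id-rec)
        (λ m (eq , _) → Boolₚ.not-¬ refl eq)))
      (Pg-∩ em (suc n)
        (Pg-∀ em (suc n) (∃-apart-Pg (not b) (not b) (pair c) (λ _ → pair l 0)
          (pair-rec (const-rec c) id-rec) (const-rec _)
          (λ m (_ , eq) → c≢l (pair-row-injective {c} {l} {m} {0} eq))))
        (Pg-∀ em (suc n) (Pg-∪ em n
          (≈-Pg (not b) (not b) (pair c) (λ _ → pair l 0)
            (pair-rec (const-rec c) id-rec) (const-rec _)
            (λ m (_ , eq) → c≢l (pair-row-injective {c} {l} {m} {0} eq)))
          (~-Pg (not b) b π₁ π₂ (π₁-rec id-rec) (π₂-rec id-rec)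
            (λ m (eq , _) → Boolₚ.not-¬ refl (sym eq))))))

  Edge-∀ᴺΓ : ∀ᴺ Γ W (uncurry Edge)
  Edge-∀ᴺΓ = Pg⇒∀ᴺ em lf
    (Pg-∩ em (suc n)
      (Pg-∩ em (suc n)
        (Pg-∪ em n (Marked-Pg true) (Marked-Pg false))
        (Pg-∪ em n
          (Pg-∀ em (suc n) (~-Pg true false (λ i → i) (λ i → i) id-rec id-rec
            (λ { _ (() , _) })))
          (Pg-∪ em n
            (Pg-∪ em n (Coding-Pg true 1 3 λ ()) (Coding-Pg true 2 4 λ ()))
            (Pg-∪ em n (Coding-Pg false 1 3 λ ()) (Coding-Pg false 2 4 λ ())))))
      -- Sequences differ iff they differ at some coordinate. The parameter is frozen at 0, and the
      -- coordinate is recovered as `π₂ (pair 0 k)`.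
      (Sg-resp (suc n)
        (λ (x , z) _ → mk⇔
          (λ ¬∃ ¬≈ → ¬≈ λ i → em⇒dne em λ x≉z →
            ¬∃ (i , subst (λ i → ¬ x i ≈ z i) (sym (π₂-pair 0 i)) x≉z))
          (λ ¬¬≈ (k , x≉z) → x≉z (em⇒dne em ¬¬≈ (π₂ (pair 0 k)))))
        (Sg-reparam (suc n) (λ _ → 0) (const-rec 0)
          (∃-apart-Pg true false π₂ π₂ (π₂-rec id-rec) (π₂-rec id-rec)
            (λ { _ (() , _) })))))

-- Paths

module _ {S : Space} where

  open Space S using (_≈_)
  open IsEquivalence (Space.isEquivalence S) using ()
    renaming (refl to ≈-refl; sym to ≈-sym; trans to ≈-trans)

  -- A step between equal points is merged into the next step or into the final `stop`.
  compress : ∀ {H G : Rel (Carrier S) 0ℓ} →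
             (∀ {x y z} → x ≈ y → G y z → G x z) → (∀ x y → H x y → G x y ⊎ x ≈ y) →
             ∀ {n x y} → Path S H n x y → ∃ λ m → m ≤ n × Path S G m x y
  compress resp split (stop x≈y) = 0 , z≤n , stop x≈y
  compress resp split (step {x = x} {y} h p) with split x y h | compress resp split p
  ... | inj₁ g   | m , m≤n , p′       = suc m , s≤s m≤n , step g p′
  ... | inj₂ x≈y | _ , m≤n , stop y≈z = 0 , z≤n , stop (≈-trans x≈y y≈z)
  ... | inj₂ x≈y | _ , m≤n , step g p′ = _ , ℕₚ.m≤n⇒m≤1+n m≤n , step (resp x≈y g) p′

  open JumpGraph S

  -- Prolonged by resting at the end point, paths of different lengths can be followed
  -- simultaneously.
  walk : ∀ {G n x y} → Path S G n x y → ∃ λ (p : ℕ → Carrier S) →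
         p 0 ≡ x × (∀ s → _~_ G (p s) (p (suc s))) × (∀ s → n ≤ s → p s ≈ y)
  walk {x = x} (stop x≈y) = (λ _ → x) , refl , (λ _ → inj₂ ≈-refl) , (λ _ _ → x≈y)
  walk {x = x} (step g q) with walk q
  ... | p , refl , p~ , p≈ =
    (λ { zero → x ; (suc s) → p s }) , refl ,
    (λ { zero → inj₁ g ; (suc s) → p~ s }) ,
    (λ { (suc s) (s≤s n≤s) → p≈ s n≤s })

-- Index sequences

if-≡ᵇ : ∀ {A : Set} m n (a b : A) →
        (m ≡ n × (if m ≡ᵇ n then a else b) ≡ a) ⊎ (¬ m ≡ n × (if m ≡ᵇ n then a else b) ≡ b)
if-≡ᵇ m n a b with m ≡ᵇ n | ℕₚ.≡ᵇ⇒≡ m n | ℕₚ.≡⇒≡ᵇ m n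
... | true  | eq | _ = inj₁ (eq _ , refl)
... | false | _  | ≢ = inj₂ (≢ , refl)

-- The first argument of `go` is fuel; by `stable` the value does not depend on it once it is at
-- least the position.
courseOfValues : ∀ {A : Set} (a : A) (rule : ℕ → A → A) (prev : ℕ → ℕ) →
                 (∀ n → prev (suc n) ≤ n) →
                 ∃ λ (e : ℕ → A) → e 0 ≡ a × (∀ n → e (suc n) ≡ rule (suc n) (e (prev (suc n))))
courseOfValues {A} a rule prev prev≤ =
  (λ n → go n n) , refl ,
  λ n → cong (rule (suc n)) (stable n (prev (suc n)) (prev (suc n)) (prev≤ n) ℕₚ.≤-refl)
  where
  go : ℕ → ℕ → A
  go (suc f) (suc n) = rule (suc n) (go f (prev (suc n)))
  go zero    _       = a
  go (suc _) zero    = a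
  stable : ∀ f f′ n → n ≤ f → n ≤ f′ → go f n ≡ go f′ n
  stable zero    zero     _       _ _ = refl
  stable zero    (suc f′) zero    _ _ = refl
  stable (suc f) zero     zero    _ _ = refl
  stable (suc f) (suc f′) zero    _ _ = refl
  stable (suc f) (suc f′) (suc n) (s≤s n≤f) (s≤s n≤f′) = cong (rule (suc n))
    (stable f f′ (prev (suc n)) (ℕₚ.≤-trans (prev≤ n) n≤f) (ℕₚ.≤-trans (prev≤ n) n≤f′))

-- Index sequences that list all of ℕ ⊎ ℕ in rows 1 and 2 and, in rows 3 and 4,
-- code the graphs of ptr₁ ∘ e and ptr₂ ∘ e.
module _ (ptr₁ ptr₂ : ℕ ⊎ ℕ → ℕ) (q₁ q₂ : ℕ ⊎ ℕ) where

  private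
    rule : ℕ → ℕ → ℕ ⊎ ℕ → ℕ ⊎ ℕ
    rule 0 _ _ = inj₁ 0
    rule 1 i _ = inj₁ i
    rule 2 i _ = inj₂ i
    -- With m coding (j , k) and `a` the index at j, the bit is set iff k is the pointer of `a`. An
    -- unset bit repeats `inj₁ 0`, the index at the reference position `pair 1 0`.
    rule 3 m a = if π₂ m ≡ᵇ ptr₁ a then q₁ else inj₁ 0
    rule _ m a = if π₂ m ≡ᵇ ptr₂ a then q₂ else inj₂ 0

  indexing : ∃ λ (e : ℕ → ℕ ⊎ ℕ) →
    (∀ i → e (pair 0 i) ≡ inj₁ 0) ×
    (∀ i → e (pair 1 i) ≡ inj₁ i) ×
    (∀ i → e (pair 2 i) ≡ inj₂ i) ×
    (∀ m → e (pair 3 m) ≡ (if π₂ m ≡ᵇ ptr₁ (e (π₁ m)) then q₁ else inj₁ 0)) ×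
    (∀ m → e (pair 4 m) ≡ (if π₂ m ≡ᵇ ptr₂ (e (π₁ m)) then q₂ else inj₂ 0))
  indexing = e , row 0 , row 1 , row 2 , row 3 , row 4
    where
    -- The bit at position `pair c (pair j k)` depends on the index at j, which is `π₁ ∘ π₂` of the
    -- position.
    course = courseOfValues (inj₁ 0) (λ n → rule (π₁ n) (π₂ n)) (π₁ ∘ π₂)
      (λ n → ℕₚ.≤-trans (π₁≤ (π₂ (suc n))) (π₂-suc≤ n))
    e = proj₁ course
    unfold : ∀ n → e n ≡ rule (π₁ n) (π₂ n) (e (π₁ (π₂ n)))
    unfold zero    = refl
    unfold (suc n) = proj₂ (proj₂ course) n
    row : ∀ c m → e (pair c m) ≡ rule c m (e (π₁ m))
    row c m = trans (unfold (pair c m)) (unpaired (λ c m → rule c m (e (π₁ m))) c m)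

-- Linked sequences and interpolating paths

module Jump (em : ExcludedMiddle 0ℓ) (S : Space) (G : Rel (Carrier S) 0ℓ)
            (G-sym : Symmetric G)
            (G-resp : ∀ {x y z} → Space._≈_ S x y → G y z → G x z) where

  open Space S using (_≈_)
  open IsEquivalence (Space.isEquivalence S) using ()
    renaming (refl to ≈-refl; sym to ≈-sym; trans to ≈-trans; reflexive to ≈-reflexive)
  open JumpGraph S G

  ~-sym : ∀ {x y} → x ~ y → y ~ x
  ~-sym (inj₁ g)   = inj₁ (G-sym g)
  ~-sym (inj₂ x≈y) = inj₂ (≈-sym x≈y)

  ~-respˡ : ∀ {x y z} → x ≈ y → y ~ z → x ~ z
  ~-respˡ x≈y (inj₁ g)   = inj₁ (G-resp x≈y g)
  ~-respˡ x≈y (inj₂ y≈z) = inj₂ (≈-trans x≈y y≈z)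

  ~-respʳ : ∀ {x y z} → x ~ y → y ≈ z → x ~ z
  ~-respʳ x~y y≈z = ~-sym (~-respˡ (≈-sym y≈z) (~-sym x~y))

  Coding⇒forth : ∀ {l c x z} → Coding l c x z → ∀ i → ∃ λ j → x i ~ z j
  Coding⇒forth {l} (link , _ , _) i = pair l i , link i

  Coding⇒back : ∀ {l c x z} → Coding l c x z → ∀ j → ∃ λ k → z j ~ x k
  Coding⇒back {l} {c} {x} {z} (_ , total , sound) j =
    let (k , coded) = total j in k , decode k coded (sound (pair j k))
    where
    decode : ∀ k → ¬ z (pair c (pair j k)) ≈ z (pair l 0) →
             z (pair c (pair j k)) ≈ z (pair l 0) ⊎ z (π₁ (pair j k)) ~ x (π₂ (pair j k)) →
             z j ~ x k
    decode k coded (inj₁ uncoded) = contradiction uncoded coded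
    decode k coded (inj₂ z~x)     = cast (unpaired (λ j k → z j ~ x k) j k) z~x

  Linked-sym : ∀ {x z} → Linked x z → Linked z x
  Linked-sym (inj₁ par)       = inj₁ (λ i → ~-sym (par i))
  Linked-sym (inj₂ (inj₁ c)) = inj₂ (inj₂ c)
  Linked-sym (inj₂ (inj₂ c)) = inj₂ (inj₁ c)

  Linked⇒forth : ∀ {x z} → Linked x z → ∀ i → ∃ λ j → x i ~ z j
  Linked⇒forth (inj₁ par)               i = i , par i
  Linked⇒forth (inj₂ (inj₁ (inj₁ c))) = Coding⇒forth {1} {3} c
  Linked⇒forth (inj₂ (inj₁ (inj₂ c))) = Coding⇒forth {2} {4} c
  Linked⇒forth (inj₂ (inj₂ (inj₁ c))) = Coding⇒back {1} {3} c
  Linked⇒forth (inj₂ (inj₂ (inj₂ c))) = Coding⇒back {2} {4} c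

  Edge-sym : Symmetric Edge
  Edge-sym ((marks , link) , x≉z) =
    (swap marks , Linked-sym link) , λ z≈x → x≉z λ i → ≈-sym (z≈x i)

  -- Each edge leads from any entry to a neighbouring entry of the next vertex. That the length is
  -- kept matters for the lower bound on the diameter.
  Edge-path⇒ : ∀ {n x z} → Path (S ^ℕ) Edge n x z → ∀ i → ∃ λ j → Path S _~_ n (x i) (z j)
  Edge-path⇒ (stop x≈z) i = i , stop (x≈z i)
  Edge-path⇒ (step ((_ , link) , _) p) i =
    let (j , x~y) = Linked⇒forth link i
        (k , q)   = Edge-path⇒ p j
    in k , step x~y q

  -- If all v a are equal, then z is constant and x and z are linked in parallel.
  module _ {x : ℕ → Carrier S} {ptr : ℕ ⊎ ℕ → ℕ} {v : ℕ ⊎ ℕ → Carrier S}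
           (x~v : ∀ a → x (ptr a) ~ v a)
           {ref : ℕ → ℕ ⊎ ℕ} (ptr-ref : ∀ i → ptr (ref i) ≡ i) where

    private
      x~ref : ∀ i → x i ~ v (ref i)
      x~ref i = subst (λ k → x k ~ v (ref i)) (ptr-ref i) (x~v (ref i))

    distinguish : ∃ λ q → (∀ a → v a ≈ v (ref 0)) ⊎ ¬ v q ≈ v (ref 0)
    distinguish with em {∃ λ q → ¬ v q ≈ v (ref 0)}
    ... | yes (q , v≉) = q , inj₂ v≉
    -- All values agree, and `ref 0` is a default index.
    ... | no  ¬∃       = ref 0 , inj₁ λ a → em⇒dne em λ v≉ → ¬∃ (a , v≉)

    link : ∀ {q l c} → (∀ a → v a ≈ v (ref 0)) ⊎ ¬ v q ≈ v (ref 0) →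
           (e : ℕ → ℕ ⊎ ℕ) →
           (∀ i → e (pair l i) ≡ ref i) →
           (∀ m → e (pair c m) ≡ (if π₂ m ≡ᵇ ptr (e (π₁ m)) then q else ref 0)) →
           Parallel x (v ∘ e) ⊎ Coding l c x (v ∘ e)
    link (inj₁ const) e _ _ = inj₁ λ i →
      ~-respʳ (x~ref i) (≈-trans (const (ref i)) (≈-sym (const (e i))))
    link {q} {l} {c} (inj₂ v≉) e row code = inj₂ (linked , total , sound)
      where
      linked : ∀ i → x i ~ v (e (pair l i))
      linked i rewrite row i = x~ref i
      total : ∀ j → ∃ λ k → ¬ v (e (pair c (pair j k))) ≈ v (e (pair l 0))
      -- The set bit in the row of j is the one at the pointer of its index.
      total j = ptr (e j) , coded
        where
        coded : ¬ v (e (pair c (pair j (ptr (e j))))) ≈ v (e (pair l 0))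
        coded rewrite code (pair j (ptr (e j))) | row 0
                    | π₁-pair j (ptr (e j)) | π₂-pair j (ptr (e j))
          with if-≡ᵇ (ptr (e j)) (ptr (e j)) q (ref 0)
        ... | inj₁ (_ , eq) rewrite eq = v≉
        ... | inj₂ (≢ , _)  = contradiction refl ≢
      sound : ∀ m → v (e (pair c m)) ≈ v (e (pair l 0)) ⊎ v (e (π₁ m)) ~ x (π₂ m)
      sound m with if-≡ᵇ (π₂ m) (ptr (e (π₁ m))) q (ref 0)
      ... | inj₁ (eq , _) rewrite eq = inj₂ (~-sym (x~v (e (π₁ m))))
      ... | inj₂ (_ , eq) = inj₁ (≈-reflexive (cong v (trans (code m) (trans eq (sym (row 0))))))

  -- Interpolates between x and y by reindexings of columns of paths w a from
  -- x (ptr₁ a) to y (ptr₂ a).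
  Core-path : ∀ k {x y : ℕ → Carrier S} (f g : ℕ → ℕ) →
    (∀ i → ∃ λ n → n ≤ 2 + k × Path S G n (x i) (y (g i))) →
    (∀ i → ∃ λ n → n ≤ 2 + k × Path S G n (x (f i)) (y i)) →
    Path (S ^ℕ) Core (2 + k) x y
  Core-path k {x} {y} f g forth back =
    -- One step from `x` to `z 1`, then k parallel steps to `z (suc k)`, and one step to `y`.
    step (inj₂ (marked 1) , from-x) (middle k 1 (ℕₚ.+-comm k 1))
    where
    ptr₁ ptr₂ : ℕ ⊎ ℕ → ℕ
    ptr₁ (inj₁ i) = i
    ptr₁ (inj₂ i) = f i
    ptr₂ (inj₁ i) = g i
    ptr₂ (inj₂ i) = i

    path : ∀ a → ∃ λ n → n ≤ 2 + k × Path S G n (x (ptr₁ a)) (y (ptr₂ a))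
    path (inj₁ i) = forth i
    path (inj₂ i) = back i

    w : ℕ ⊎ ℕ → ℕ → Carrier S
    w a = proj₁ (walk (proj₂ (proj₂ (path a))))

    w~ : ∀ a s → w a s ~ w a (suc s)
    w~ a = proj₁ (proj₂ (proj₂ (walk (proj₂ (proj₂ (path a))))))

    x~w : ∀ a → x (ptr₁ a) ~ w a 1
    x~w a = ~-respˡ (≈-reflexive (sym (proj₁ (proj₂ (walk (proj₂ (proj₂ (path a)))))))) (w~ a 0)

    y~w : ∀ a → y (ptr₂ a) ~ w a (suc k)
    y~w a = ~-sym (~-respʳ (w~ a (suc k))
      (proj₂ (proj₂ (proj₂ (walk (proj₂ (proj₂ (path a)))))) (2 + k) (proj₁ (proj₂ (path a)))))

    q₁ = distinguish {x} {ptr₁} x~w {inj₁} (λ _ → refl)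
    q₂ = distinguish {y} {ptr₂} y~w {inj₂} (λ _ → refl)

    index = indexing ptr₁ ptr₂ (proj₁ q₁) (proj₁ q₂)
    e = proj₁ index

    z : ℕ → ℕ → Carrier S
    z s n = w (e n) s

    marked : ∀ s → Marked (z s)
    marked s rewrite proj₁ (proj₂ index) 0 | proj₁ (proj₂ index) 1 = ≈-refl

    from-x : Linked x (z 1)
    from-x with link {x} {ptr₁} x~w {inj₁} (λ _ → refl) {proj₁ q₁} {1} {3} (proj₂ q₁) e
      (proj₁ (proj₂ (proj₂ index))) (proj₁ (proj₂ (proj₂ (proj₂ (proj₂ index)))))
    ... | inj₁ par = inj₁ par
    ... | inj₂ c   = inj₂ (inj₁ (inj₁ c))

    from-y : Linked y (z (suc k))
    from-y with link {y} {ptr₂} y~w {inj₂} (λ _ → refl) {proj₁ q₂} {2} {4} (proj₂ q₂) e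
      (proj₁ (proj₂ (proj₂ (proj₂ index)))) (proj₂ (proj₂ (proj₂ (proj₂ (proj₂ index)))))
    ... | inj₁ par = inj₁ par
    ... | inj₂ c   = inj₂ (inj₁ (inj₂ c))

    middle : ∀ r s → r + s ≡ suc k → Path (S ^ℕ) Core (suc r) (z s) y
    middle zero    s refl = step (inj₁ (marked s) , Linked-sym from-y) (stop λ _ → ≈-refl)
    middle (suc r) s eq   = step (inj₁ (marked s) , inj₁ λ i → w~ (e i) s)
      (middle r (suc s) (trans (ℕₚ.+-suc r s) eq))

-- Connectedness and diameter of the jump graph

module _ {A : Set} {E : Rel A 0ℓ} (E-equiv : IsEquivalence E) where

  open IsEquivalence E-equiv using () renaming (refl to E-refl; sym to E-sym; trans to E-trans)

  E⇒≐ : ∀ {x y} → E x y → E x ≐ E y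
  E⇒≐ xEy = E-trans (E-sym xEy) , E-trans xEy

  ≐⇒E : ∀ {x y} → E x ≐ E y → E x y
  ≐⇒E x≐y = proj₂ x≐y E-refl

  ⁺-intro : ∀ {x y} → (∀ i → ∃ λ j → E (x i) (y j)) → (∀ j → ∃ λ i → E (y j) (x i)) → (E ⁺) x y
  ⁺-intro forth back =
    (λ i → let (j , xEy) = forth i in j , E⇒≐ xEy) ,
    (λ j → let (i , yEx) = back j in i , E⇒≐ yEx)

theorem7p1 : ExcludedMiddle 0ℓ →
    (Γ : Pointclass) → IsLightface Γ →
    (X : RecursivePolishSpace) →
    (∃₂ λ (x y : Carrier (space X)) → ¬ (Space._≈_ (space X) x y)) →
    (_≺_ : Rel (Carrier (space X)) 0ℓ) →
    IsStrictTotalOrder (Space._≈_ (space X)) _≺_ →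
    Σ⁰ 1 (space X ×ₛ space X) (uncurry _≺_) →
    (E : Rel (Carrier (space X)) 0ℓ) → IsEquivalenceOn (space X) E →
    (ℓ : ℕ) →
    GraphableWithDiameter Γ (space X) E ℓ →
    GraphableWithDiameter (∀ᴺ Γ) (space X ^ℕ) (E ⁺) (2 ⊔ ℓ)
theorem7p1 em Γ lf X (a , b , a≉b) _≺_ ≺-order ≺-Σ⁰₁ E E-equiv ℓ
  (G , G-graphs , G-diam≤ , G-diam≥) =
  Edge ,
  record
    { symmetric   = Edge-sym
    ; irreflexive = λ x≈y (_ , x≉y) → x≉y x≈y
    ; inΓ         = Edge-Γ
    ; connected⇔E = λ x y → mk⇔ connected⇒E⁺ λ xEy → let (n , _ , p) = E⁺⇒path xEy in n , p
    } ,
  (λ x y c → E⁺⇒path (connected⇒E⁺ c)) ,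
  λ m m-diam → ℕₚ.⊔-lub (2≤diameter m m-diam) (ℓ≤diameter m m-diam)
  where
  S : Space
  S = space X
  open Space S using (_≈_)
  open IsEquivalence (Space.isEquivalence S) using ()
    renaming (refl to ≈-refl; sym to ≈-sym; trans to ≈-trans; reflexive to ≈-reflexive)
  open IsEquivalenceOn E-equiv using ()
    renaming (isEquivalence to E-isEquivalence; reflexive to ≈⇒E)
  open IsEquivalence E-isEquivalence using () renaming (sym to E-sym; trans to E-trans)
  module G = IsGraphing G-graphs

  G-resp : ∀ {x y z} → x ≈ y → G y z → G x z
  G-resp x≈y = Γ-resp-≈ lf {S ×ₛ S} {uncurry G} G.inΓ (≈-sym x≈y , ≈-refl)

  open JumpGraph S G using (_~_; Edge; Core; Marked)
  open Jump em S G G.symmetric G-resp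

  Edge-Γ : ∀ᴺ Γ (S ^ℕ ×ₛ S ^ℕ) (uncurry Edge)
  Edge-Γ = Edge-∀ᴺΓ em lf X ≺-order ≺-Σ⁰₁ G.inΓ

  Edge-resp : ∀ {x y z} → (∀ i → x i ≈ y i) → Edge y z → Edge x z
  Edge-resp x≈y = ∀ᴺ-resp-≈ lf {S ^ℕ ×ₛ S ^ℕ} {uncurry Edge} Edge-Γ
    ((λ i → ≈-sym (x≈y i)) , λ _ → ≈-refl)

  G-path⇒E : ∀ {n x y} → Path S G n x y → E x y
  G-path⇒E p = to (G.connected⇔E _ _) (_ , p)

  Edge-path⇒E : ∀ {n x y} → Path (S ^ℕ) Edge n x y → ∀ i → ∃ λ j → E (x i) (y j)
  Edge-path⇒E p i = let (j , q)     = Edge-path⇒ p i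
                        (_ , _ , r) = compress G-resp (λ _ _ h → h) q
                    in j , G-path⇒E r

  reverse : ∀ {n x y} → Path (S ^ℕ) Edge n x y → ∀ j → ∃ λ i → E (y j) (x i)
  reverse (stop x≈y) j = j , ≈⇒E (≈-sym (x≈y j))
  reverse (step e p) k =
    let (j , zEy) = reverse p k
        (i , yEx) = Edge-path⇒E (step (Edge-sym e) (stop λ _ → ≈-refl)) j
    in i , E-trans zEy yEx

  connected⇒E⁺ : ∀ {x y} → Connected (S ^ℕ) Edge x y → (E ⁺) x y
  connected⇒E⁺ (_ , p) = ⁺-intro E-isEquivalence (Edge-path⇒E p) (reverse p)

  Core⇒Edge : ∀ x y → Core x y → Edge x y ⊎ (∀ i → x i ≈ y i)
  Core⇒Edge x y c with em {∀ i → x i ≈ y i}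
  ... | yes x≈y = inj₂ x≈y
  ... | no  x≉y = inj₁ (c , x≉y)

  -- Writing `2 ⊔ ℓ` as `2 + k` provides the interior vertex that carries the codes. `compress` then
  -- removes the steps between equal sequences, which are no edges.
  E⁺⇒path : ∀ {x y} → (E ⁺) x y → ∃ λ n → n ≤ 2 ⊔ ℓ × Path (S ^ℕ) Edge n x y
  E⁺⇒path {x} {y} (forth , back) = path (ℕₚ.m≤n⇒∃[o]m+o≡n (ℕₚ.m≤m⊔n 2 ℓ))
    where
    G-path : ∀ {k x y} → 2 + k ≡ 2 ⊔ ℓ → E x y → ∃ λ n → n ≤ 2 + k × Path S G n x y
    G-path 2+k≡ xEy = let (n , n≤ℓ , p) = G-diam≤ _ _ (from (G.connected⇔E _ _) xEy) in
      n , subst (n ≤_) (sym 2+k≡) (ℕₚ.≤-trans n≤ℓ (ℕₚ.m≤n⊔m 2 ℓ)) , p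
    path : (∃ λ k → 2 + k ≡ 2 ⊔ ℓ) → ∃ λ n → n ≤ 2 ⊔ ℓ × Path (S ^ℕ) Edge n x y
    path (k , 2+k≡) = subst (λ l → ∃ λ n → n ≤ l × Path (S ^ℕ) Edge n x y) 2+k≡
      (compress Edge-resp Core⇒Edge
        (Core-path k (λ j → proj₁ (back j)) (λ i → proj₁ (forth i))
          (λ i → G-path 2+k≡ (≐⇒E E-isEquivalence (proj₂ (forth i))))
          (λ j → G-path 2+k≡ (E-sym (≐⇒E E-isEquivalence (proj₂ (back j)))))))

  -- Following coordinate 0 along a path between constant sequences gives a path in `G` that is no
  -- longer, and every entry of the end is the same point.
  ℓ≤diameter : ∀ m → DiameterAtMost (S ^ℕ) Edge m → ℓ ≤ m
  ℓ≤diameter m m-diam = G-diam≥ m λ x y c →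
    let xEy         = to (G.connected⇔E x y) c
        (_ , _ , p) = E⁺⇒path (⁺-intro E-isEquivalence (λ _ → 0 , xEy) (λ _ → 0 , E-sym xEy))
        (n , n≤m , q) = m-diam (λ _ → x) (λ _ → y) (_ , p)
        (n′ , n′≤n , r) = compress G-resp (λ _ _ h → h) (proj₂ (Edge-path⇒ q 0))
    in n′ , ℕₚ.≤-trans n′≤n n≤m , r

  -- Two enumerations of { a , b } neither of which is marked.
  2≤diameter : ∀ m → DiameterAtMost (S ^ℕ) Edge m → 2 ≤ m
  2≤diameter m m-diam =
    let (_ , _ , p)   = E⁺⇒path u⁺v
        (n , n≤m , q) = m-diam u v (_ , p)
    in ℕₚ.≤-trans (long q) n≤m
    where
    u v : ℕ → Carrier S
    u zero    = a
    u (suc _) = b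
    v zero    = b
    v (suc _) = a
    u⁺v : (E ⁺) u v
    u⁺v = ⁺-intro E-isEquivalence
      (λ { zero → 1 , ≈⇒E ≈-refl ; (suc _) → 0 , ≈⇒E ≈-refl })
      (λ { zero → 1 , ≈⇒E ≈-refl ; (suc _) → 0 , ≈⇒E ≈-refl })
    long : ∀ {n} → Path (S ^ℕ) Edge n u v → 2 ≤ n
    long (stop u≈v)          = contradiction (u≈v 0) a≉b
    long (step _ (step _ _)) = s≤s (s≤s z≤n)
    -- `pair 0 0` is 0 and `pair 0 1` is 2, so a mark on `u`, or one carried over from z to `v`,
    -- would identify `a` and `b`.
    long (step ((inj₁ u-marked , _) , _) (stop _))   = contradiction u-marked a≉b
    long (step ((inj₂ z-marked , _) , _) (stop z≈v)) =
      contradiction (≈-trans (≈-trans (≈-sym (z≈v _)) (≈-sym z-marked)) (z≈v _)) a≉b
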